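{- Let $q=4n+1$ be a prime with $n\ge 3$, and let $r=q+1$. Let $S,T,u_0,u_1,H_1,H_2,G_1,G_2$ be the sets, integers and graphs specified in the context. Then the amalgam graph $B^*_q(S,T,u_0,u_1)$ is an $(\{r,2r-5\};5)$-cage of order $r(2r-5)+1$.
   Context: All graphs are finite, undirected and simple. The girth of a graph is the length of a shortest cycle. For integers $2\le r<m$, an $(\{r,m\};g)$-graph is a graph of girth exactly $g$ whose set of vertex degrees is exactly $\{r,m\}$, and an $(\{r,m\};g)$-cage is an $(\{r,m\};g)$-graph of minimum possible order. Here $GF(q)=\mathbb Z_q$ (integers mod $q$), $\mathbb Z_q^*=\mathbb Z_q\setminus\{0\}$, and $\alpha$ is a fixed generator of the multiplicative group $\mathbb Z_q^*$. The graph $B_q$ is the bipartite graph with vertex classes $V_0=\{(x,y)_0: x,y\in\mathbb Z_q\}$ and $V_1=\{(m,b)_1: m,b\in\mathbb Z_q\}$, in which $(x,y)_0$ is adjacent to $(m,b)_1$ if and only if $y=mx+b$. For $x,m\in \mathbb Z_q$ put $P_x=\{(x,y)_0: y\in\mathbb Z_q\}$ and $L_m=\{(m,b)_1: b\in\mathbb Z_q\}$. General construction. For $T\subseteq S\subseteq\mathbb Z_q$ and integers $0\le u_0\le u_1<q-1$, let $U_i=\{\alpha^{q-j}: j=2,\dots,u_i+1\}$ for $i=0,1$ (empty if $u_i=0$). The graph $B_q(S,T,u_0,u_1)$ is obtained from $B_q$ by deleting the vertices $(0,y)_0$ with $y\in S$, the vertices $(0,b)_1$ with $b\in T$, all blocks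 $P_x$ with $x\in U_0$, and all blocks $L_m$ with $m\in U_1$. Given graphs $H_1,H_2,G_1,G_2$ with vertex sets $\mathbb Z_q\setminus S$, $\mathbb Z_q\setminus T$, $\mathbb Z_q$, $\mathbb Z_q$ respectively, the amalgam $B^*_q(S,T,u_0,u_1)$ is obtained from $B_q(S,T,u_0,u_1)$ by adding the edges: $(0,u)_0(0,v)_0$ for $uv\in E(H_1)$; $(0,u)_1(0,v)_1$ for $uv\in E(H_2)$; $(x,u)_0(x,v)_0$ for $x\in\mathbb Z_q^*\setminus U_0$ and $uv\in E(G_1)$; $(m,u)_1(m,v)_1$ for $m\in\mathbb Z_q^*\setminus U_1$ and $uv\in E(G_2)$. Choice of parameters ($q\equiv 1 \bmod 4$; all elements and sums are taken modulo $q$): $S=\{\frac{q-1}{4},\frac{3q+1}{4}\}$, $T=\emptyset$, $u_0=0$, $u_1=1$ (so $U_0=\emptyset$, $U_1=\{\alpha^{q-2}\}$). $H_1$ has vertex set $\mathbb Z_q\setminus\{\frac{q-1}{4},\frac{3q+1}{4}\}$ and edges $\{j,j+\frac{q-1}{2}\}$ for $j\in\mathbb Z_q\setminus\{\frac{q-1}{4},\frac{3q+1}{4},\frac{q+3}{4}\}$ together with $\{\frac{3q-3}{4},\frac{q+3}{4}\}$ (a $(q-2)$-cycle). $G_1$ has vertex set $\mathbb Z_q$ and edges $\{j,j+\frac{q-1}{2}\}$ for $j\in\mathbb Z_q$ (a $q$-cycle). $H_2$ and $G_2$ are both the graph with vertex set $\mathbb Z_q$ and edges $\{0,j\}$ for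 $j\in\mathbb Z_q^*\setminus\{\frac{q-1}{2},\frac{q+1}{2}\}$ together with $\{\frac{q-1}{4},\frac{q-1}{2}\}$ and $\{\frac{3q+1}{4},\frac{q+1}{2}\}$. -}

module Defs where

open import Data.Fin using (Fin; toℕ)
import Data.Fin.Properties as Fin
open import Data.Fin.Subset using (Subset; ⁅_⁆; _∪_; ⋃; _∈_; _∉_) renaming (⊥ to ∅)
open import Data.Fin.Subset.Properties using (_∈?_)
open import Data.List
  using (List; []; _∷_; _++_; _∷ʳ_; map; filter; length; upTo; allFin; cartesianProduct)
import Data.List.Membership.Propositional as List
open import Data.List.Membership.Propositional.Properties
  using (∈-map⁺; ∈-map⁻; ∈-++⁺ˡ; ∈-++⁺ʳ; ∈-allFin; ∈-cartesianProduct⁺)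
open import Data.List.Relation.Unary.Any using (here; there)
open import Data.List.Relation.Unary.Linked using (Linked)
open import Data.List.Relation.Unary.Unique.Propositional using (Unique)
import Data.List.Relation.Unary.Unique.Propositional.Properties as Unique
open import Data.Nat using (ℕ; NonZero; _≤_; _∸_; _^_) renaming (_+_ to _+ℕ_; _*_ to _*ℕ_)
open import Data.Nat.DivMod using (_/_; _mod_)
open import Data.Irrelevant using ([_])
open import Data.Product using (∃-syntax; _×_; _,_)
open import Data.Refinement using (Refinement-syntax; value; _,_)
open import Data.Sum using (_⊎_; inj₁; inj₂; swap)
import Data.Sum as Sum
open import Data.Sum.Properties using (inj₁-injective; inj₂-injective)
open import Data.Empty using (⊥; ⊥-elim)
open import Function using (_∘_; _on_; _⇔_)
open import Level using (0ℓ)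
open import Relation.Binary
  using (Rel; Decidable; DecidableEquality; Irreflexive; Symmetric)
open import Relation.Binary.PropositionalEquality
  using (_≡_; _≢_; refl; sym; trans; cong; subst)
open import Relation.Nullary using (¬_; yes; no; recompute)
open import Relation.Nullary.Decidable using (map′; ¬?; _×-dec_; _⊎-dec_)
open import Relation.Unary using (Pred) renaming (Decidable to Decidable₁)

record Finite (A : Set) : Set where
  field
    elements : List A
    unique   : Unique elements
    complete : ∀ x → x List.∈ elements

  card : ℕ
  card = length elements

open Finite

Fin-finite : ∀ n → Finite (Fin n)
Fin-finite n = record
  { elements = allFin n
  ; unique   = Unique.allFin⁺ n
  ; complete = ∈-allFin
  }

module _ {A B : Set} (fA : Finite A) (fB : Finite B) where

  ×-finite : Finite (A × B)
  ×-finite = record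
    { elements = cartesianProduct (elements fA) (elements fB)
    ; unique   = Unique.cartesianProduct⁺ (unique fA) (unique fB)
    ; complete = λ { (x , y) → ∈-cartesianProduct⁺ (complete fA x) (complete fB y) }
    }

  ⊎-finite : Finite (A ⊎ B)
  ⊎-finite = record
    { elements = map inj₁ (elements fA) ++ map inj₂ (elements fB)
    ; unique   = Unique.++⁺ (Unique.map⁺ inj₁-injective (unique fA))
                            (Unique.map⁺ inj₂-injective (unique fB))
                            disjoint
    ; complete = λ where
        (inj₁ x) → ∈-++⁺ˡ (∈-map⁺ inj₁ (complete fA x))
        (inj₂ y) → ∈-++⁺ʳ _ (∈-map⁺ inj₂ (complete fB y))
    }
    where
    disjoint : ∀ {z} → ¬ (z List.∈ map inj₁ (elements fA) × z List.∈ map inj₂ (elements fB))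
    disjoint (p , q) with ∈-map⁻ inj₁ p | ∈-map⁻ inj₂ q
    ... | _ , _ , refl | _ , _ , ()

module _ {A : Set} {P : Pred A 0ℓ} (P? : Decidable₁ P) where

  refineList : List A → List [ x ∈ A ∣ P x ]
  refineList []       = []
  refineList (x ∷ xs) with P? x
  ... | yes p = (x , [ p ]) ∷ refineList xs
  ... | no  _ = refineList xs

  value-refineList : ∀ xs → map value (refineList xs) ≡ filter P? xs
  value-refineList []       = refl
  value-refineList (x ∷ xs) with P? x
  ... | yes p = cong (x ∷_) (value-refineList xs)
  ... | no ¬p = value-refineList xs

  refineList-complete : ∀ (v : [ x ∈ A ∣ P x ]) {xs} → value v List.∈ xs → v List.∈ refineList xs
  refineList-complete (x , [ p ]) {y ∷ _} (here refl) with P? y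
  ... | yes _ = here refl
  ... | no ¬p = ⊥-elim (¬p (recompute (P? y) p))
  refineList-complete v {y ∷ _} (there x∈xs) with P? y
  ... | yes _ = there (refineList-complete v x∈xs)
  ... | no  _ = refineList-complete v x∈xs

  Refinement-finite : Finite A → Finite [ x ∈ A ∣ P x ]
  Refinement-finite fA = record
    { elements = refineList (elements fA)
    ; unique   = Unique.map⁻
        (subst Unique (sym (value-refineList (elements fA))) (Unique.filter⁺ P? (unique fA)))
    ; complete = λ v → refineList-complete v (complete fA (value v))
    }

record Graph (V : Set) : Set₁ where
  field
    finite : Finite V
    Adj    : Rel V 0ℓ
    adj?   : Decidable Adj
    symm   : Symmetric Adj
    irrefl : Irreflexive _≡_ Adj

  order : ℕ
  order = card finite

  degree : V → ℕ
  degree v = length (filter (adj? v) (elements finite))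

  -- The cycle v - v₁ - ⋯ - vₖ - v, where vs = v₁ ⋯ vₖ.
  record IsCycle (v : V) (vs : List V) : Set where
    field
      long     : 3 ≤ length (v ∷ vs)
      distinct : Unique (v ∷ vs)
      closed   : Linked Adj (v ∷ vs ∷ʳ v)

  record HasGirth (g : ℕ) : Set where
    field
      attained : ∃[ v ] ∃[ vs ] IsCycle v vs × length (v ∷ vs) ≡ g
      shortest : ∀ v vs → IsCycle v vs → g ≤ length (v ∷ vs)

open Graph

record Is[_,_⨾_]-graph (r m g : ℕ) {V : Set} (G : Graph V) : Set where
  field
    girth   : HasGirth G g
    degrees : ∀ d → (∃[ v ] degree G v ≡ d) ⇔ (d ≡ r ⊎ d ≡ m)

record Is[_,_⨾_]-cage (r m g : ℕ) {V : Set} (G : Graph V) : Set₁ where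
  field
    isGraph : Is[ r , m ⨾ g ]-graph G
    minimal : ∀ {W : Set} (G′ : Graph W) → Is[ r , m ⨾ g ]-graph G′ → order G ≤ order G′

-- Pairs with u ≡ v are discarded, since graphs are simple; the edge relations
-- used below contain none once q is large enough.
fromRel : ∀ {V} → Finite V → DecidableEquality V →
          (R : Rel V 0ℓ) → Decidable R → Graph V
fromRel fV _≟_ R R? = record
  { finite = fV
  ; Adj    = λ u v → u ≢ v × (R u v ⊎ R v u)
  ; adj?   = λ u v → ¬? (u ≟ v) ×-dec (R? u v ⊎-dec R? v u)
  ; symm   = λ { (u≢v , e) → u≢v ∘ sym , swap e }
  ; irrefl = λ { u≡v (u≢v , _) → u≢v u≡v }
  }

induced : ∀ {V} → Graph V → {P : Pred V 0ℓ} → Decidable₁ P → Graph [ v ∈ V ∣ P v ]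
induced G P? = record
  { finite = Refinement-finite P? (finite G)
  ; Adj    = Adj G on value
  ; adj?   = λ u v → adj? G (value u) (value v)
  ; symm   = symm G
  ; irrefl = λ u≡v → irrefl G (cong value u≡v)
  }

-- Adjacency of G, as a relation on the type whose elements G's vertices refine.
data AdjIn {V : Set} {P : Pred V 0ℓ} (G : Graph [ v ∈ V ∣ P v ]) (u v : V) : Set where
  adj : .(p : P u) .(p′ : P v) → Adj G (u , [ p ]) (v , [ p′ ]) → AdjIn G u v

module _ {V : Set} {P : Pred V 0ℓ} (P? : Decidable₁ P) (G : Graph [ v ∈ V ∣ P v ]) where

  adjIn? : Decidable (AdjIn G)
  adjIn? u v with P? u | P? v
  ... | no ¬p | _      = no λ { (adj p _ _) → ¬p (recompute (P? u) p) }
  ... | yes _ | no ¬p  = no λ { (adj _ p _) → ¬p (recompute (P? v) p) }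
  ... | yes p | yes p′ =
    map′ (adj p p′) (λ { (adj _ _ e) → e }) (adj? G (u , [ p ]) (v , [ p′ ]))

adjIn-sym : ∀ {V} {P : Pred V 0ℓ} (G : Graph [ v ∈ V ∣ P v ]) → Symmetric (AdjIn G)
adjIn-sym G (adj p p′ e) = adj p′ p (symm G e)

adjIn-irrefl : ∀ {V} {P : Pred V 0ℓ} (G : Graph [ v ∈ V ∣ P v ]) → Irreflexive _≡_ (AdjIn G)
adjIn-irrefl G refl (adj _ _ e) = irrefl G refl e

module _ {q : ℕ} .{{_ : NonZero q}} where

  infixl 6 _+_
  infixl 7 _*_
  infixr 8 _↑_

  ι : ℕ → Fin q
  ι k = k mod q

  _+_ _*_ : Fin q → Fin q → Fin q
  x + y = ι (toℕ x +ℕ toℕ y)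
  x * y = ι (toℕ x *ℕ toℕ y)

  _↑_ : Fin q → ℕ → Fin q
  x ↑ k = ι (toℕ x ^ k)

  IsGenerator : Fin q → Set
  IsGenerator α = α ≢ ι 0 × (∀ x → x ≢ ι 0 → ∃[ k ] x ≡ α ↑ k)

BVertex : ℕ → Set
BVertex q = (Fin q × Fin q) ⊎ (Fin q × Fin q)

pattern ⟨_,_⟩₀ x y = inj₁ (x , y)
pattern ⟨_,_⟩₁ m b = inj₂ (m , b)

module _ {q : ℕ} .{{_ : NonZero q}} where

  BAdj : Rel (BVertex q) 0ℓ
  BAdj ⟨ x , y ⟩₀ ⟨ m , b ⟩₁ = y ≡ m * x + b
  BAdj ⟨ m , b ⟩₁ ⟨ x , y ⟩₀ = y ≡ m * x + b
  BAdj ⟨ _ , _ ⟩₀ ⟨ _ , _ ⟩₀ = ⊥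
  BAdj ⟨ _ , _ ⟩₁ ⟨ _ , _ ⟩₁ = ⊥

  BAdj? : Decidable BAdj
  BAdj? ⟨ x , y ⟩₀ ⟨ m , b ⟩₁ = y Fin.≟ m * x + b
  BAdj? ⟨ m , b ⟩₁ ⟨ x , y ⟩₀ = y Fin.≟ m * x + b
  BAdj? ⟨ _ , _ ⟩₀ ⟨ _ , _ ⟩₀ = no λ ()
  BAdj? ⟨ _ , _ ⟩₁ ⟨ _ , _ ⟩₁ = no λ ()

  BAdj-sym : Symmetric BAdj
  BAdj-sym {⟨ _ , _ ⟩₀} {⟨ _ , _ ⟩₁} e = e
  BAdj-sym {⟨ _ , _ ⟩₁} {⟨ _ , _ ⟩₀} e = e

  BAdj-irrefl : Irreflexive _≡_ BAdj
  BAdj-irrefl {⟨ _ , _ ⟩₀} refl ()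
  BAdj-irrefl {⟨ _ , _ ⟩₁} refl ()

  B : Graph (BVertex q)
  B = record
    { finite = ⊎-finite (×-finite (Fin-finite q) (Fin-finite q))
                        (×-finite (Fin-finite q) (Fin-finite q))
    ; Adj    = BAdj
    ; adj?   = BAdj?
    ; symm   = λ {u} {v} → BAdj-sym {u} {v}
    ; irrefl = BAdj-irrefl
    }

  -- { α^(q-j) : 2 ≤ j ≤ u+1 }, written with j = 2 + i.
  U : (α : Fin q) (u : ℕ) → Subset q
  U α u = ⋃ (map (λ i → ⁅ α ↑ (q ∸ (2 +ℕ i)) ⁆) (upTo u))

  module _ (α : Fin q) (S T : Subset q) (u₀ u₁ : ℕ) where

    Kept : Pred (BVertex q) 0ℓ
    Kept ⟨ x , y ⟩₀ = ¬ (x ≡ ι 0 × y ∈ S) × x ∉ U α u₀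
    Kept ⟨ m , b ⟩₁ = ¬ (m ≡ ι 0 × b ∈ T) × m ∉ U α u₁

    kept? : Decidable₁ Kept
    kept? ⟨ x , y ⟩₀ = ¬? ((x Fin.≟ ι 0) ×-dec (y ∈? S)) ×-dec ¬? (x ∈? U α u₀)
    kept? ⟨ m , b ⟩₁ = ¬? ((m Fin.≟ ι 0) ×-dec (b ∈? T)) ×-dec ¬? (m ∈? U α u₁)

    Breduced : Graph [ v ∈ BVertex q ∣ Kept v ]
    Breduced = induced B kept?

    -- Used on both sides: (x , y) stands for (x,y)₀ when H, G, u are H₁, G₁, u₀ and
    -- for (x,y)₁ when they are H₂, G₂, u₁.
    BlockAdj : ∀ {R : Subset q} → Graph [ y ∈ Fin q ∣ y ∉ R ] → Graph (Fin q) → ℕ →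
               Rel (Fin q × Fin q) 0ℓ
    BlockAdj H G u (x , y) (x′ , y′) = x ≡ x′ ×
      (x ≡ ι 0 × AdjIn H y y′ ⊎ (x ≢ ι 0 × x ∉ U α u) × Adj G y y′)

    module _ {R : Subset q} (H : Graph [ y ∈ Fin q ∣ y ∉ R ]) (G : Graph (Fin q)) (u : ℕ) where

      blockAdj? : Decidable (BlockAdj H G u)
      blockAdj? (x , y) (x′ , y′) = (x Fin.≟ x′) ×-dec
        (((x Fin.≟ ι 0) ×-dec adjIn? (λ z → ¬? (z ∈? R)) H y y′) ⊎-dec
         ((¬? (x Fin.≟ ι 0) ×-dec ¬? (x ∈? U α u)) ×-dec adj? G y y′))

      blockAdj-sym : Symmetric (BlockAdj H G u)
      blockAdj-sym (refl , e) =
        refl , Sum.map (λ { (z , h) → z , adjIn-sym H h }) (λ { (z , g) → z , symm G g }) e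

      blockAdj-irrefl : Irreflexive _≡_ (BlockAdj H G u)
      blockAdj-irrefl refl (_ , inj₁ (_ , h)) = adjIn-irrefl H refl h
      blockAdj-irrefl refl (_ , inj₂ (_ , g)) = irrefl G refl g

    module _ (H₁ : Graph [ y ∈ Fin q ∣ y ∉ S ]) (H₂ : Graph [ b ∈ Fin q ∣ b ∉ T ])
             (G₁ G₂ : Graph (Fin q)) where

      AddedAdj : Rel (BVertex q) 0ℓ
      AddedAdj (inj₁ p) (inj₁ p′) = BlockAdj H₁ G₁ u₀ p p′
      AddedAdj (inj₂ l) (inj₂ l′) = BlockAdj H₂ G₂ u₁ l l′
      AddedAdj (inj₁ _) (inj₂ _)  = ⊥
      AddedAdj (inj₂ _) (inj₁ _)  = ⊥

      addedAdj? : Decidable AddedAdj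
      addedAdj? (inj₁ p) (inj₁ p′) = blockAdj? H₁ G₁ u₀ p p′
      addedAdj? (inj₂ l) (inj₂ l′) = blockAdj? H₂ G₂ u₁ l l′
      addedAdj? (inj₁ _) (inj₂ _)  = no λ ()
      addedAdj? (inj₂ _) (inj₁ _)  = no λ ()

      addedAdj-sym : Symmetric AddedAdj
      addedAdj-sym {inj₁ _} {inj₁ _} e = blockAdj-sym H₁ G₁ u₀ e
      addedAdj-sym {inj₂ _} {inj₂ _} e = blockAdj-sym H₂ G₂ u₁ e

      addedAdj-irrefl : Irreflexive _≡_ AddedAdj
      addedAdj-irrefl {inj₁ _} refl e = blockAdj-irrefl H₁ G₁ u₀ refl e
      addedAdj-irrefl {inj₂ _} refl e = blockAdj-irrefl H₂ G₂ u₁ refl e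

      amalgam : Graph [ v ∈ BVertex q ∣ Kept v ]
      amalgam = record
        { finite = finite Breduced
        ; Adj    = λ v w → Adj Breduced v w ⊎ AddedAdj (value v) (value w)
        ; adj?   = λ v w → adj? Breduced v w ⊎-dec addedAdj? (value v) (value w)
        ; symm   = λ {v} {w} →
            Sum.map (symm Breduced {v} {w}) (addedAdj-sym {value v} {value w})
        ; irrefl = λ where
            v≡w (inj₁ e) → irrefl Breduced v≡w e
            v≡w (inj₂ e) → addedAdj-irrefl (cong value v≡w) e
        }

module _ {q : ℕ} .{{_ : NonZero q}} where

  -- For q ≡ 1 (mod 4) every division by 2 or 4 below is exact.
  S T : Subset q
  S = ⁅ ι ((q ∸ 1) / 4) ⁆ ∪ ⁅ ι ((3 *ℕ q +ℕ 1) / 4) ⁆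
  T = ∅

  h : Fin q
  h = ι ((q ∸ 1) / 2)

  H₁-edge : Rel (Fin q) 0ℓ
  H₁-edge j k = ((j ∉ S × j ≢ ι ((q +ℕ 3) / 4)) × k ≡ j + h)
              ⊎ (j ≡ ι ((3 *ℕ q ∸ 3) / 4) × k ≡ ι ((q +ℕ 3) / 4))

  H₁-edge? : Decidable H₁-edge
  H₁-edge? j k = ((¬? (j ∈? S) ×-dec ¬? (j Fin.≟ _)) ×-dec (k Fin.≟ _))
           ⊎-dec ((j Fin.≟ _) ×-dec (k Fin.≟ _))

  H₁ : Graph [ j ∈ Fin q ∣ j ∉ S ]
  H₁ = induced (fromRel (Fin-finite q) Fin._≟_ H₁-edge H₁-edge?) (λ j → ¬? (j ∈? S))

  G₁ : Graph (Fin q)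
  G₁ = fromRel (Fin-finite q) Fin._≟_ (λ j k → k ≡ j + h) (λ _ _ → _ Fin.≟ _)

  G₂-edge : Rel (Fin q) 0ℓ
  G₂-edge i j = (i ≡ ι 0 × j ≢ ι 0 × j ≢ ι ((q ∸ 1) / 2) × j ≢ ι ((q +ℕ 1) / 2))
              ⊎ (i ≡ ι ((q ∸ 1) / 4) × j ≡ ι ((q ∸ 1) / 2))
              ⊎ (i ≡ ι ((3 *ℕ q +ℕ 1) / 4) × j ≡ ι ((q +ℕ 1) / 2))

  G₂-edge? : Decidable G₂-edge
  G₂-edge? i j =
    ((i Fin.≟ _) ×-dec ¬? (j Fin.≟ _) ×-dec ¬? (j Fin.≟ _) ×-dec ¬? (j Fin.≟ _))
    ⊎-dec ((i Fin.≟ _) ×-dec (j Fin.≟ _))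
    ⊎-dec ((i Fin.≟ _) ×-dec (j Fin.≟ _))

  G₂ : Graph (Fin q)
  G₂ = fromRel (Fin-finite q) Fin._≟_ G₂-edge G₂-edge?

  -- G₂ itself, up to the renaming of Fin q as the refinement { j ∉ T }, T = ∅.
  H₂ : Graph [ j ∈ Fin q ∣ j ∉ T ]
  H₂ = induced G₂ (λ j → ¬? (j ∈? T))

{-# OPTIONS --safe #-}
-- A vertex of degree m in a graph of girth 5 has m neighbours and at least m (r - 1) vertices at
-- distance two, all distinct, so such a graph has at least r m + 1 vertices. The amalgam attains
-- this bound, so only its girth and its degrees are in question. Two vertices of B_q have at most
-- one common neighbour and no vertex has two neighbours in one class P_x or L_m, so every
-- triangle or square of the amalgam is contained in one class or consists of an edge of some P_x
-- and an edge of some L_m incident endpointwise. The former is impossible because H₁, G₁ and G₂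
-- are a (q-2)-cycle, a q-cycle and a tree. For the latter the two edges have the same difference
-- of ordinates; but the differences in G₁ are ±(q-1)/2, which do not occur in G₂, and the
-- exceptional edge of H₁, in P_0, would have to be an edge of G₂.
module Submission where

open import Defs hiding (_+_; _*_)
open import Defs using () renaming (_+_ to _⊕_; _*_ to _⊗_)
open import Algebra.Bundles using (CommutativeRing)
open import Data.Empty using (⊥; ⊥-elim)
open import Data.Fin using (Fin; toℕ)
import Data.Fin.Properties as Fin
open import Data.Fin.Subset using (_∈_; _∉_)
open import Data.Fin.Subset.Properties
  using (∉⊥; x∈⁅x⁆; x∈⁅y⁆⇒x≡y; x∈p∪q⁺; x∈p∪q⁻) renaming (_∈?_ to _∈ₛ?_)
open import Data.Irrelevant using ([_])
open import Data.List
  using (List; []; _∷_; _++_; _∷ʳ_; map; concatMap; filter; length; lookup; allFin; cartesianProduct)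
import Data.List.Membership.Propositional as List
open import Data.List.Membership.Propositional.Properties
  using (∈-filter⁺; ∈-filter⁻; ∈-map⁺; ∈-map⁻; ∈-++⁺ˡ; ∈-++⁺ʳ; ∈-++⁻; ∈-concatMap⁻; ∈-allFin)
open import Data.List.Membership.Propositional.Properties.WithK using (unique∧set⇒bag)
import Data.List.Properties as List
open import Data.List.Relation.Binary.BagAndSetEquality using (∼bag⇒↭)
open import Data.List.Relation.Binary.Disjoint.Propositional using (Disjoint)
open import Data.List.Relation.Binary.Permutation.Propositional.Properties using (↭-length)
open import Data.List.Relation.Unary.All as All using (All; []; _∷_)
import Data.List.Relation.Unary.All.Properties as All
open import Data.List.Relation.Unary.AllPairs as AllPairs using ([]; _∷_)
import Data.List.Relation.Unary.AllPairs.Properties as AllPairs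
open import Data.List.Relation.Unary.Any as Any using (here; there; index)
open import Data.List.Relation.Unary.Any.Properties using (lookup-index)
open import Data.List.Relation.Unary.Linked using (Linked; [-]; _∷_)
open import Data.List.Relation.Unary.Unique.Propositional using (Unique)
import Data.List.Relation.Unary.Unique.Propositional.Properties as Unique
open import Data.Nat
  using (ℕ; zero; suc; NonZero; >-nonZero⁻¹; _≤_; _<_; _≤?_; _<?_; _∸_; _+_; _*_; _^_; z≤n; s≤s)
open import Data.Nat.Divisibility using (_∣_; m%n≡0⇒n∣m; n∣m⇒m%n≡0; >⇒∤)
open import Data.Nat.DivMod
  using (_%_; _/_; m%n<n; m<n⇒m%n≡m; n%n≡0; %-distribˡ-+; %-distribˡ-*; [m+kn]%n≡m%n; m*n/n≡m)
open import Data.Nat.Primality using (Prime; euclidsLemma)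
import Data.Nat.Properties as ℕ
open import Data.Nat.Tactic.RingSolver using (solve-∀)
open import Data.Product using (∃-syntax; _×_; _,_; proj₁; proj₂)
open import Data.Refinement using (Refinement-syntax; value; value-injective; _,_)
open import Data.Sum as Sum using (_⊎_; inj₁; inj₂; swap)
open import Data.Sum.Properties using (inj₁-injective; inj₂-injective)
open import Function using (_∘_; id; mk⇔; Equivalence)
open import Level using (0ℓ)
open import Relation.Binary using (Rel; Symmetric; DecidableEquality; _⇒_)
open import Relation.Binary.PropositionalEquality
open import Relation.Nullary using (¬_; Dec; yes; no; recompute)
open import Relation.Nullary.Decidable using (map′; ¬?; _×-dec_; decidable-stable; True; toWitness)
open import Relation.Unary using (Pred; Decidable)

open Finite
open Graph

-- The deletions are chosen to balance the degrees. A point loses its one line in the deleted block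
-- and gains two neighbours from a cycle, so its degree is (q - 1) + 2 = r. A line of intercept b
-- has up to q points, and as many further neighbours as b has in G₂. A leaf b gives q + 1 = r, and
-- the root 0 gives q + (q - 3) = 2r - 5. The two vertices (q-1)/4 and (3q+1)/4 of G₂ have degree 2,
-- one too many, and S consists of exactly these: the point (0,b)₀ lies on every line of intercept
-- b, so its deletion takes back the surplus neighbour.

-- Counting in finite types

unique-length : ∀ {A : Set} {xs ys : List A} → Unique xs → Unique ys →
                (∀ {z} → z List.∈ xs → z List.∈ ys) → (∀ {z} → z List.∈ ys → z List.∈ xs) →
                length xs ≡ length ys
unique-length ux uy f g = ↭-length (∼bag⇒↭ (unique∧set⇒bag ux uy (mk⇔ f g)))

unique-pair : ∀ {A : Set} {x y : A} → x ≢ y → Unique (x ∷ y ∷ [])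
unique-pair x≢y = (x≢y ∷ []) ∷ [] ∷ []

module _ {A : Set} (fA : Finite A) where

  infix 4 _≟_ _∈?_

  -- The position at which `complete` finds an element determines it. The graphs competing with the
  -- amalgam live on arbitrary types, where finiteness is the only source of decidable equality.
  _≟_ : DecidableEquality A
  x ≟ y = map′ index-injective (λ { refl → refl })
               (index (complete fA x) Fin.≟ index (complete fA y))
    where
    index-injective : index (complete fA x) ≡ index (complete fA y) → x ≡ y
    index-injective e = trans (lookup-index (complete fA x))
      (trans (cong (lookup (elements fA)) e) (sym (lookup-index (complete fA y))))

  _∈?_ : ∀ x xs → Dec (x List.∈ xs)
  x ∈? xs = Any.any? (x ≟_) xs

  -- Counts a large set by listing the few elements outside it; the additive form avoids truncated
  -- subtraction. Taking for P the property of not occurring in a list gives the pigeonhole bound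
  -- `length≤card`.
  length-complement : ∀ {P : Pred A 0ℓ} (P? : Decidable P) {es} → Unique es →
    (∀ {x} → x List.∈ es → ¬ P x) → (∀ {x} → ¬ P x → x List.∈ es) →
    length (filter P? (elements fA)) + length es ≡ card fA
  length-complement P? {es} ue es⊆ ⊆es =
    trans (sym (List.length-++ (filter P? (elements fA))))
      (unique-length
        (Unique.++⁺ (Unique.filter⁺ P? (unique fA)) ue
          (λ (x∈f , x∈es) → es⊆ x∈es (proj₂ (∈-filter⁻ P? {xs = elements fA} x∈f))))
        (unique fA) (λ _ → complete fA _) covers)
    where
    covers : ∀ {z} → z List.∈ elements fA → z List.∈ filter P? (elements fA) ++ es
    covers {z} z∈ with P? z
    ... | yes p = ∈-++⁺ˡ (∈-filter⁺ P? z∈ p)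
    ... | no ¬p = ∈-++⁺ʳ _ (⊆es ¬p)

  length≤card : ∀ {xs} → Unique xs → length xs ≤ card fA
  length≤card {xs} u = subst (length xs ≤_)
    (length-complement (λ x → ¬? (x ∈? xs)) u (λ x∈ x∉ → x∉ x∈)
      (λ {x} → decidable-stable (x ∈? xs)))
    (ℕ.m≤n+m _ _)

card-refinement : ∀ {A : Set} {P : Pred A 0ℓ} (P? : Decidable P) (fA : Finite A) →
  card (Refinement-finite P? fA) ≡ length (filter P? (elements fA))
card-refinement P? fA = trans (sym (List.length-map value (refineList P? (elements fA))))
  (cong length (value-refineList P? (elements fA)))

-- Elements of a refinement are determined by their values, since the proofs are irrelevant, so
-- neighbours can be counted in the underlying type without carrying the proofs along.
degree-refined : ∀ {A : Set} {P : Pred A 0ℓ} (G : Graph [ x ∈ A ∣ P x ]) v {ns : List A} →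
  Unique ns → (∀ {w} → Adj G v w → value w List.∈ ns) →
  (∀ {x} → x List.∈ ns → ∃[ w ] value w ≡ x × Adj G v w) →
  degree G v ≡ length ns
degree-refined G v un ⊆ns ns⊆ =
  trans (sym (List.length-map value N))
    (unique-length (Unique.map⁺ value-injective (Unique.filter⁺ (adj? G v) (unique (finite G)))) un
      to from)
  where
  N = filter (adj? G v) (elements (finite G))
  to : ∀ {z} → z List.∈ map value N → z List.∈ _
  to z∈ with w , w∈ , refl ← ∈-map⁻ value z∈ =
    ⊆ns (proj₂ (∈-filter⁻ (adj? G v) {xs = elements (finite G)} w∈))
  from : ∀ {z} → z List.∈ _ → z List.∈ map value N
  from z∈ with w , refl , e ← ns⊆ z∈ =
    ∈-map⁺ value (∈-filter⁺ (adj? G v) (complete (finite G) w) e)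

-- Relations without triangles and squares, and girth 5

-- Stated for bare relations so that it applies to orientations and single blocks too. Since
-- `no-triangle` does not ask for distinct vertices, it includes irreflexivity (take a = b = c); in
-- `no-square` only opposite corners then have to be assumed distinct.
record Squarefree {V : Set} (_~_ : Rel V 0ℓ) : Set where
  field
    no-triangle : ∀ {a b c} → a ~ b → b ~ c → c ~ a → ⊥
    no-square   : ∀ {a b c d} → a ≢ c → b ≢ d → a ~ b → b ~ c → c ~ d → d ~ a → ⊥

open Squarefree

module _ {V : Set} (G : Graph V) where

  adj⇒≢ : ∀ {u v} → Adj G u v → u ≢ v
  adj⇒≢ e u≡v = irrefl G u≡v e

  girth5⇒squarefree : HasGirth G 5 → Squarefree (Adj G)
  girth5⇒squarefree girth = record
    { no-triangle = λ {a} {b} {c} ab bc ca → absurd₃ (shortest a (b ∷ c ∷ []) (record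
        { long     = s≤s (s≤s (s≤s z≤n))
        ; distinct = (adj⇒≢ ab ∷ adj⇒≢ ca ∘ sym ∷ []) ∷ (adj⇒≢ bc ∷ []) ∷ [] ∷ []
        ; closed   = ab ∷ bc ∷ ca ∷ [-]
        }))
    ; no-square = λ {a} {b} {c} {d} a≢c b≢d ab bc cd da →
        absurd₄ (shortest a (b ∷ c ∷ d ∷ []) (record
        { long     = s≤s (s≤s (s≤s z≤n))
        ; distinct = (adj⇒≢ ab ∷ a≢c ∷ adj⇒≢ da ∘ sym ∷ []) ∷ (adj⇒≢ bc ∷ b≢d ∷ [])
                     ∷ (adj⇒≢ cd ∷ []) ∷ [] ∷ []
        ; closed   = ab ∷ bc ∷ cd ∷ da ∷ [-]
        }))
    }
    where
    open HasGirth girth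
    absurd₃ : ¬ 5 ≤ 3
    absurd₃ (s≤s (s≤s (s≤s ())))
    absurd₄ : ¬ 5 ≤ 4
    absurd₄ (s≤s (s≤s (s≤s (s≤s ()))))

  squarefree⇒cycle≥5 : Squarefree (Adj G) → ∀ v vs → IsCycle G v vs → 5 ≤ length (v ∷ vs)
  squarefree⇒cycle≥5 sf v vs cyc = go vs long distinct closed
    where
    open IsCycle cyc
    go : ∀ vs → 3 ≤ length (v ∷ vs) → Unique (v ∷ vs) → Linked (Adj G) (v ∷ vs ∷ʳ v) →
         5 ≤ length (v ∷ vs)
    go (_ ∷ [])         (s≤s (s≤s ()))
    go (_ ∷ _ ∷ [])     _ _ (ab ∷ bc ∷ ca ∷ [-]) = ⊥-elim (no-triangle sf ab bc ca)
    go (_ ∷ _ ∷ _ ∷ []) _ ((_ ∷ a≢c ∷ _) ∷ (_ ∷ b≢d ∷ _) ∷ _) (ab ∷ bc ∷ cd ∷ da ∷ [-]) =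
      ⊥-elim (no-square sf a≢c b≢d ab bc cd da)
    go (_ ∷ _ ∷ _ ∷ _ ∷ _) _ _ _ = s≤s (s≤s (s≤s (s≤s (s≤s z≤n))))

-- The Moore-type bound around a vertex

length-concatMap-≥ : ∀ {A B : Set} (f : A → List B) {k} xs →
                     (∀ {x} → x List.∈ xs → k ≤ length (f x)) → length xs * k ≤ length (concatMap f xs)
length-concatMap-≥ f []       _ = z≤n
length-concatMap-≥ f (x ∷ xs) b = subst (_ ≤_) (sym (List.length-++ (f x)))
  (ℕ.+-mono-≤ (b (here refl)) (length-concatMap-≥ f xs (b ∘ there)))

module _ {V : Set} (G : Graph V) (sf : Squarefree (Adj G)) where

  private
    _≟ᵥ_ = _≟_ (finite G)
    els  = elements (finite G)

    nbrs : V → List V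
    nbrs v = filter (adj? G v) els

    beyond? : ∀ v w → Decidable (λ z → (z ≢ v × Adj G v w) × Adj G w z)
    beyond? v w z = (¬? (z ≟ᵥ v) ×-dec adj? G v w) ×-dec adj? G w z

    -- Testing Adj G v w makes it recoverable from membership, hence in the disjointness proofs.
    beyond : V → V → List V
    beyond v w = filter (beyond? v w) els

    nbrs⁻ : ∀ {v w} → w List.∈ nbrs v → Adj G v w
    nbrs⁻ {v} w∈ = proj₂ (∈-filter⁻ (adj? G v) {xs = els} w∈)

    beyond⁻ : ∀ {v w z} → z List.∈ beyond v w → (z ≢ v × Adj G v w) × Adj G w z
    beyond⁻ {v} {w} z∈ = proj₂ (∈-filter⁻ (beyond? v w) {xs = els} z∈)

    nbrs! : ∀ v → Unique (nbrs v)
    nbrs! v = Unique.filter⁺ (adj? G v) (unique (finite G))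

    beyond! : ∀ v w → Unique (beyond v w)
    beyond! v w = Unique.filter⁺ (beyond? v w) (unique (finite G))

    length-beyond : ∀ {v w} → Adj G v w → length (beyond v w) + 1 ≡ degree G w
    length-beyond {v} {w} vw = trans (sym (List.length-++ (beyond v w)))
      (unique-length (Unique.++⁺ (beyond! v w) ([] ∷ [])
          (λ { (z∈ , here refl) → proj₁ (proj₁ (beyond⁻ z∈)) refl }))
        (nbrs! w) to from)
      where
      to : ∀ {z} → z List.∈ beyond v w ++ v ∷ [] → z List.∈ nbrs w
      to z∈ with ∈-++⁻ (beyond v w) z∈
      ... | inj₁ z∈b         = ∈-filter⁺ (adj? G w) (complete (finite G) _) (proj₂ (beyond⁻ z∈b))
      ... | inj₂ (here refl) = ∈-filter⁺ (adj? G w) (complete (finite G) _) (symm G vw)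
      from : ∀ {z} → z List.∈ nbrs w → z List.∈ beyond v w ++ v ∷ []
      from {z} z∈ with z ≟ᵥ v
      ... | yes refl = ∈-++⁺ʳ (beyond v w) (here refl)
      ... | no z≢v   = ∈-++⁺ˡ
        (∈-filter⁺ (beyond? v w) (complete (finite G) z) ((z≢v , vw) , nbrs⁻ z∈))

    ball : V → List V
    ball v = v ∷ nbrs v ++ concatMap (beyond v) (nbrs v)

    -- A neighbour of v that also lies beyond another neighbour closes a triangle, and a vertex
    -- beyond two different neighbours closes a square.
    ball! : ∀ v → Unique (ball v)
    ball! v = All.++⁺ (All.tabulate (λ w∈ v≡w → adj⇒≢ G (nbrs⁻ w∈) v≡w))
                      (All.tabulate (λ z∈ v≡z → proj₁ (proj₁ (proj₂ (far z∈))) (sym v≡z)))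
            ∷ Unique.++⁺ (nbrs! v)
                (Unique.concat⁺ (All.map⁺ (All.universal (beyond! v) (nbrs v)))
                  (AllPairs.map⁺ (AllPairs.map apart (nbrs! v))))
                (λ (z∈ , z∈′) → let w , (_ , vw) , wz = far z∈′ in
                  no-triangle sf vw wz (symm G (nbrs⁻ z∈)))
      where
      far : ∀ {z} → z List.∈ concatMap (beyond v) (nbrs v) →
            ∃[ w ] ((z ≢ v × Adj G v w) × Adj G w z)
      far z∈ with w , _ , z∈w ← List.find (∈-concatMap⁻ (beyond v) {xs = nbrs v} z∈) = w , beyond⁻ z∈w
      apart : ∀ {w w′} → w ≢ w′ → Disjoint (beyond v w) (beyond v w′)
      apart w≢w′ (z∈ , z∈′) with (z≢v , vw) , wz ← beyond⁻ z∈ | (_ , vw′) , w′z ← beyond⁻ z∈′ =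
        no-square sf (z≢v ∘ sym) w≢w′ vw wz (symm G w′z) (symm G vw′)

  moore-bound : ∀ {k} v → (∀ w → suc k ≤ degree G w) → degree G v * suc k + 1 ≤ order G
  moore-bound {k} v δ = ℕ.≤-trans size (length≤card (finite G) (ball! v))
    where
    d = degree G v
    size : d * suc k + 1 ≤ length (ball v)
    size = begin
      d * suc k + 1                                            ≡⟨ ℕ.+-comm _ 1 ⟩
      suc (d * suc k)                                          ≡⟨ cong suc (ℕ.*-suc d k) ⟩
      suc (d + d * k)                                          ≤⟨ s≤s (ℕ.+-monoʳ-≤ d far) ⟩
      suc (d + length (concatMap (beyond v) (nbrs v)))         ≡⟨ cong suc (List.length-++ (nbrs v)) ⟨
      length (ball v)                                          ∎
      where
      open ℕ.≤-Reasoning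
      step : ∀ {w} → w List.∈ nbrs v → k ≤ length (beyond v w)
      step {w} w∈ = ℕ.+-cancelʳ-≤ 1 k _ (subst₂ _≤_ (ℕ.+-comm 1 k)
        (sym (length-beyond (nbrs⁻ w∈))) (δ w))

      far : d * k ≤ length (concatMap (beyond v) (nbrs v))
      far = length-concatMap-≥ (beyond v) (nbrs v) step

-- Arithmetic modulo q

module Field (q : ℕ) .{{_ : NonZero q}} where

  private
    0%q≡0 : 0 % q ≡ 0
    0%q≡0 = m<n⇒m%n≡m (>-nonZero⁻¹ q)

  toℕ-ι : ∀ k → toℕ (ι {q} k) ≡ k % q
  toℕ-ι k = Fin.toℕ-fromℕ< (m%n<n k q)

  ι-toℕ : ∀ (x : Fin q) → ι (toℕ x) ≡ x
  ι-toℕ x = Fin.toℕ-injective (trans (toℕ-ι (toℕ x)) (m<n⇒m%n≡m (Fin.toℕ<n x)))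

  ι-cong : ∀ {j k} → j % q ≡ k % q → ι {q} j ≡ ι k
  ι-cong {j} {k} e = Fin.toℕ-injective (trans (toℕ-ι j) (trans e (sym (toℕ-ι k))))

  ι≡0⇒∣ : ∀ {k} → ι {q} k ≡ ι 0 → q ∣ k
  ι≡0⇒∣ {k} e = m%n≡0⇒n∣m k q
    (trans (sym (toℕ-ι k)) (trans (cong toℕ e) (trans (toℕ-ι 0) 0%q≡0)))

  ∣⇒ι≡0 : ∀ {k} → q ∣ k → ι {q} k ≡ ι 0
  ∣⇒ι≡0 {k} q∣k = ι-cong (trans (n∣m⇒m%n≡0 k q q∣k) (sym 0%q≡0))

  ι-homo-+ : ∀ j k → ι {q} (j + k) ≡ ι j ⊕ ι k
  ι-homo-+ j k = ι-cong (trans (%-distribˡ-+ j k q)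
    (cong₂ (λ a b → (a + b) % q) (sym (toℕ-ι j)) (sym (toℕ-ι k))))

  ι-homo-* : ∀ j k → ι {q} (j * k) ≡ ι j ⊗ ι k
  ι-homo-* j k = ι-cong (trans (%-distribˡ-* j k q)
    (cong₂ (λ a b → (a * b) % q) (sym (toℕ-ι j)) (sym (toℕ-ι k))))

  ⊝_ : Fin q → Fin q
  ⊝ x = ι (q ∸ toℕ x)

  private
    ⊕-ιʳ : ∀ (x : Fin q) k → x ⊕ ι k ≡ ι (toℕ x + k)
    ⊕-ιʳ x k = trans (cong (_⊕ ι k) (sym (ι-toℕ x))) (sym (ι-homo-+ (toℕ x) k))

    ⊕-ιˡ : ∀ k (x : Fin q) → ι k ⊕ x ≡ ι (k + toℕ x)
    ⊕-ιˡ k x = trans (cong (ι k ⊕_) (sym (ι-toℕ x))) (sym (ι-homo-+ k (toℕ x)))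

    ⊗-ιʳ : ∀ (x : Fin q) k → x ⊗ ι k ≡ ι (toℕ x * k)
    ⊗-ιʳ x k = trans (cong (_⊗ ι k) (sym (ι-toℕ x))) (sym (ι-homo-* (toℕ x) k))

    ⊗-ιˡ : ∀ k (x : Fin q) → ι k ⊗ x ≡ ι (k * toℕ x)
    ⊗-ιˡ k x = trans (cong (ι k ⊗_) (sym (ι-toℕ x))) (sym (ι-homo-* k (toℕ x)))

    ⊕-comm : ∀ (x y : Fin q) → x ⊕ y ≡ y ⊕ x
    ⊕-comm x y = cong ι (ℕ.+-comm (toℕ x) (toℕ y))

    ⊕-assoc : ∀ (x y z : Fin q) → (x ⊕ y) ⊕ z ≡ x ⊕ (y ⊕ z)
    ⊕-assoc x y z = trans (⊕-ιˡ _ z)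
      (trans (cong ι (ℕ.+-assoc (toℕ x) (toℕ y) (toℕ z))) (sym (⊕-ιʳ x _)))

    ⊕-identityˡ : ∀ (x : Fin q) → ι 0 ⊕ x ≡ x
    ⊕-identityˡ x = trans (⊕-ιˡ 0 x) (ι-toℕ x)

    ⊕-inverseˡ : ∀ x → (⊝ x) ⊕ x ≡ ι 0
    ⊕-inverseˡ x = trans (⊕-ιˡ _ x)
      (trans (cong ι (ℕ.m∸n+n≡m (ℕ.<⇒≤ (Fin.toℕ<n x)))) (ι-cong (trans (n%n≡0 q) (sym 0%q≡0))))

    ⊗-comm : ∀ (x y : Fin q) → x ⊗ y ≡ y ⊗ x
    ⊗-comm x y = cong ι (ℕ.*-comm (toℕ x) (toℕ y))

    ⊗-assoc : ∀ (x y z : Fin q) → (x ⊗ y) ⊗ z ≡ x ⊗ (y ⊗ z)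
    ⊗-assoc x y z = trans (⊗-ιˡ _ z)
      (trans (cong ι (ℕ.*-assoc (toℕ x) (toℕ y) (toℕ z))) (sym (⊗-ιʳ x _)))

    ⊗-identityˡ : ∀ (x : Fin q) → ι 1 ⊗ x ≡ x
    ⊗-identityˡ x = trans (⊗-ιˡ 1 x) (trans (cong ι (ℕ.+-identityʳ (toℕ x))) (ι-toℕ x))

    ⊗-distribˡ-⊕ : ∀ (x y z : Fin q) → x ⊗ (y ⊕ z) ≡ (x ⊗ y) ⊕ (x ⊗ z)
    ⊗-distribˡ-⊕ x y z = trans (⊗-ιʳ x _)
      (trans (cong ι (ℕ.*-distribˡ-+ (toℕ x) (toℕ y) (toℕ z))) (ι-homo-+ (toℕ x * toℕ y) (toℕ x * toℕ z)))

  commutativeRing : CommutativeRing 0ℓ 0ℓ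
  commutativeRing = record
    { Carrier = Fin q
    ; _≈_ = _≡_
    ; _+_ = _⊕_
    ; _*_ = _⊗_
    ; -_  = ⊝_
    ; 0#  = ι 0
    ; 1#  = ι 1
    ; isCommutativeRing = record
      { isRing = record
        { +-isAbelianGroup = record
          { isGroup = record
            { isMonoid = record
              { isSemigroup = record
                { isMagma = record { isEquivalence = isEquivalence ; ∙-cong = cong₂ _⊕_ }
                ; assoc = ⊕-assoc
                }
              ; identity = comm∧idˡ⇒id ⊕-comm ⊕-identityˡ
              }
            ; inverse = comm∧invˡ⇒inv ⊕-comm ⊕-inverseˡ
            ; ⁻¹-cong = cong ⊝_
            }
          ; comm = ⊕-comm
          }
        ; *-cong     = cong₂ _⊗_
        ; *-assoc    = ⊗-assoc
        ; *-identity = comm∧idˡ⇒id ⊗-comm ⊗-identityˡ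
        ; distrib    = ⊗-distribˡ-⊕ , comm∧distrˡ⇒distrʳ ⊗-comm ⊗-distribˡ-⊕
        }
      ; *-comm = ⊗-comm
      }
    }
    where
    open import Algebra.Consequences.Propositional
      using (comm∧idˡ⇒id; comm∧invˡ⇒inv; comm∧distrˡ⇒distrʳ)

  open CommutativeRing commutativeRing public
    using (+-assoc; +-comm; +-identityˡ; +-identityʳ; zeroˡ; zeroʳ; *-identityʳ)
  open CommutativeRing commutativeRing using (ring; distribʳ)
  open import Algebra.Properties.Ring ring public
    using (+-cancelˡ; +-cancelʳ; x[y-z]≈xy-xz; x≈y⇒x∙y⁻¹≈ε; x∙y⁻¹≈ε⇒x≈y; //-rightDividesˡ; //-rightDividesʳ)

  -- The difference of the representatives leaves the remainder `suc e` modulo q, which is strictly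
  -- between 0 and q. The multiple k allows representatives beyond q.
  ι-≢ : ∀ {a b e} k → b ≡ a + (suc e + k * q) → suc e < q → ι {q} a ≢ ι b
  ι-≢ {a} {b} {e} k refl e<q eq = >⇒∤ e<q (ι≡0⇒∣ (+-cancelˡ (ι a) _ _ (begin
    ι a ⊕ ι (suc e)           ≡⟨ cong (ι a ⊕_) (ι-cong ([m+kn]%n≡m%n (suc e) k q)) ⟨
    ι a ⊕ ι (suc e + k * q)   ≡⟨ ι-homo-+ a _ ⟨
    ι (a + (suc e + k * q))   ≡⟨ eq ⟨
    ι a                       ≡⟨ +-identityʳ (ι a) ⟨
    ι a ⊕ ι 0                 ∎)))
    where open ≡-Reasoning

  module _ (pr : Prime q) where

    no-zero-divisors : ∀ {x y : Fin q} → x ⊗ y ≡ ι 0 → x ≡ ι 0 ⊎ y ≡ ι 0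
    no-zero-divisors {x} {y} e with euclidsLemma (toℕ x) (toℕ y) pr (ι≡0⇒∣ e)
    ... | inj₁ q∣x = inj₁ (trans (sym (ι-toℕ x)) (∣⇒ι≡0 q∣x))
    ... | inj₂ q∣y = inj₂ (trans (sym (ι-toℕ y)) (∣⇒ι≡0 q∣y))

    ↑-≢0 : ∀ {x : Fin q} k → ι 1 ≢ ι {q} 0 → x ≢ ι 0 → x ↑ k ≢ ι 0
    ↑-≢0 zero    1≢0 x≢0 e = 1≢0 e
    ↑-≢0 {x} (suc k) 1≢0 x≢0 e with no-zero-divisors (trans (sym (⊗-↑ x k)) e)
      where
      ⊗-↑ : ∀ x k → x ↑ suc k ≡ x ⊗ (x ↑ k)
      ⊗-↑ x k = trans (ι-homo-* (toℕ x) (toℕ x ^ k)) (cong (_⊗ (x ↑ k)) (ι-toℕ x))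
    ... | inj₁ x≡0  = x≢0 x≡0
    ... | inj₂ xk≡0 = ↑-≢0 k 1≢0 x≢0 xk≡0

    -- Subtracting the two equations gives (m - m′)(x - x′) = 0, and there are no zero divisors
    -- modulo a prime.
    two-points-one-line : ∀ {m m′ x x′ b b′} → m ⊗ x ⊕ b ≡ m′ ⊗ x ⊕ b′ →
                          m ⊗ x′ ⊕ b ≡ m′ ⊗ x′ ⊕ b′ → m ≡ m′ ⊎ x ≡ x′
    two-points-one-line {m} {m′} {x} {x′} {b} {b′} e e′ with no-zero-divisors prod
      where
      d = m ⊕ ⊝ m′
      slope : ∀ {z} → m ⊗ z ⊕ b ≡ m′ ⊗ z ⊕ b′ → d ⊗ z ⊕ b ≡ b′
      slope {z} eq = +-cancelˡ (m′ ⊗ z) _ _ (begin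
        m′ ⊗ z ⊕ (d ⊗ z ⊕ b)  ≡⟨ +-assoc (m′ ⊗ z) _ b ⟨
        m′ ⊗ z ⊕ d ⊗ z ⊕ b    ≡⟨ cong (_⊕ b) (distribʳ z m′ d) ⟨
        (m′ ⊕ d) ⊗ z ⊕ b      ≡⟨ cong (λ t → t ⊗ z ⊕ b) (trans (+-comm m′ d) (//-rightDividesˡ m′ m)) ⟩
        m ⊗ z ⊕ b             ≡⟨ eq ⟩
        m′ ⊗ z ⊕ b′           ∎)
        where open ≡-Reasoning
      prod : d ⊗ (x ⊕ ⊝ x′) ≡ ι 0
      prod = trans (x[y-z]≈xy-xz d x x′)
        (x≈y⇒x∙y⁻¹≈ε (+-cancelʳ b _ _ (trans (slope e) (sym (slope e′)))))
    ... | inj₁ z = inj₁ (x∙y⁻¹≈ε⇒x≈y _ _ z)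
    ... | inj₂ z = inj₂ (x∙y⁻¹≈ε⇒x≈y _ _ z)

-- Short cycles in orientations of out-degree at most one

squarefree-⊆ : ∀ {V} {_~_ _≈_ : Rel V 0ℓ} → _~_ ⇒ _≈_ → Squarefree _≈_ → Squarefree _~_
squarefree-⊆ f sf = record
  { no-triangle = λ ab bc ca → no-triangle sf (f ab) (f bc) (f ca)
  ; no-square   = λ a≢c b≢d ab bc cd da → no-square sf a≢c b≢d (f ab) (f bc) (f cd) (f da)
  }

-- A short cycle in an orientation of out-degree at most one is a directed circuit.
module _ {V : Set} {_⇝_ : Rel V 0ℓ}
         (functional : ∀ {a b c} → a ⇝ b → a ⇝ c → b ≡ c)
         (no-circuit₃ : ∀ {a b c} → a ⇝ b → b ⇝ c → c ⇝ a → ⊥)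
         (no-circuit₄ : ∀ {a b c d} → a ⇝ b → b ⇝ c → c ⇝ d → d ⇝ a → ⊥) where

  private
    _~_ : Rel V 0ℓ
    a ~ b = a ⇝ b ⊎ b ⇝ a

    no-loop : ∀ {a} → ¬ a ⇝ a
    no-loop aa = no-circuit₃ aa aa aa

    no-transit : ∀ {a b c} → a ⇝ b → a ⇝ c → ¬ b ⇝ c
    no-transit ab ac bc with refl ← functional ab ac = no-loop bc

    triangle : ∀ {a b c} → a ~ b → b ~ c → c ~ a → ⊥
    triangle (inj₁ ab) (inj₁ bc) (inj₁ ca) = no-circuit₃ ab bc ca
    triangle (inj₁ ab) (inj₁ bc) (inj₂ ac) = no-transit ab ac bc
    triangle (inj₁ ab) (inj₂ cb) (inj₁ ca) = no-transit ca cb ab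
    triangle (inj₁ ab) (inj₂ cb) (inj₂ ac) = no-transit ac ab cb
    triangle (inj₂ ba) (inj₁ bc) (inj₁ ca) = no-transit bc ba ca
    triangle (inj₂ ba) (inj₁ bc) (inj₂ ac) = no-transit ba bc ac
    triangle (inj₂ ba) (inj₂ cb) (inj₁ ca) = no-transit cb ca ba
    triangle (inj₂ ba) (inj₂ cb) (inj₂ ac) = no-circuit₃ ac cb ba

    -- If the four arrows do not all run the same way round, some corner is the tail of both its
    -- edges, and functionality identifies the two corners next to it, which are opposite each
    -- other.
    square : ∀ {a b c d} → a ≢ c → b ≢ d → a ~ b → b ~ c → c ~ d → d ~ a → ⊥
    square a≢c b≢d (inj₁ ab) (inj₁ bc) (inj₁ cd) (inj₁ da) = no-circuit₄ ab bc cd da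
    square a≢c b≢d (inj₂ ba) (inj₂ cb) (inj₂ dc) (inj₂ ad) = no-circuit₄ ad dc cb ba
    square a≢c b≢d (inj₁ ab) _ _ (inj₂ ad) = b≢d (functional ab ad)
    square a≢c b≢d (inj₂ ba) (inj₁ bc) _ _ = a≢c (functional ba bc)
    square a≢c b≢d _ (inj₂ cb) (inj₁ cd) _ = b≢d (functional cb cd)
    square a≢c b≢d _ _ (inj₂ dc) (inj₁ da) = a≢c (functional da dc)

  oriented⇒squarefree : Squarefree (λ a b → a ⇝ b ⊎ b ⇝ a)
  oriented⇒squarefree = record { no-triangle = triangle ; no-square = square }

-- The constants of the construction and the block graphs

*-/-exact : ∀ {a} d k .{{_ : NonZero d}} → a ≡ d * k → a / d ≡ k
*-/-exact d k refl = trans (cong (_/ d) (ℕ.*-comm d k)) (m*n/n≡m k d)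

-- Subscripts give the value of a constant when q = 4n + 1, where n = j + 3; also h = 2n, h′ = 2n + 1.

module Blocks (q : ℕ) .{{_ : NonZero q}} (j : ℕ) (q≡ : q ≡ 4 * j + 13) where

  open Field q

  h′ cₙ cₙ₊₁ c₃ₙ c₃ₙ₊₁ : Fin q
  h′    = ι ((q + 1) / 2)
  cₙ    = ι ((q ∸ 1) / 4)
  cₙ₊₁  = ι ((q + 3) / 4)
  c₃ₙ   = ι ((3 * q ∸ 3) / 4)
  c₃ₙ₊₁ = ι ((3 * q + 1) / 4)

  -- Recording the constants as a j + b reduces (in)equalities between them to numerals.
  record _≐_,_ (x : Fin q) (a b : ℕ) : Set where
    constructor form
    field value≡ : x ≡ ι (a * j + b)

  private
    scale : ∀ d a b → d * (a * j + b) ≡ (d * a) * j + d * b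
    scale d a b = trans (ℕ.*-distribˡ-+ d (a * j) b) (cong (_+ d * b) (sym (ℕ.*-assoc d a j)))

    split : ∀ a a′ b b′ → (a + a′) * j + (b + b′) ≡ (a * j + b) + (a′ * j + b′)
    split a a′ b b′ = trans (cong (_+ (b + b′)) (ℕ.*-distribʳ-+ j a a′))
      (ℕ-medial (a * j) (a′ * j) b b′)
      where open import Algebra.Properties.CommutativeSemigroup ℕ.+-commutativeSemigroup
              renaming (interchange to ℕ-medial)

    -- As q itself has the coefficients 4 and 13, pairs that differ by a multiple of (4 , 13) denote
    -- the same residue.
    split-multiple : ∀ a k b → (a + k * 4) * j + (b + k * 13) ≡ (a * j + b) + k * q
    split-multiple a k b = trans (split a (k * 4) b (k * 13))
      (cong (a * j + b +_) (trans (sym (scale k 4 13)) (cong (k *_) (sym q≡))))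

    fraction : ∀ {k} d a b .{{_ : NonZero d}} → k ≡ (d * a) * j + d * b → ι (k / d) ≐ a , b
    fraction d a b k≡ = form (cong ι (*-/-exact d (a * j + b) (trans k≡ (sym (scale d a b)))))

    q∸1≡ : q ∸ 1 ≡ 4 * j + 12
    q∸1≡ = trans (cong (_∸ 1) q≡) (ℕ.+-∸-assoc (4 * j) {13} (s≤s z≤n))

    q+≡ : ∀ c → q + c ≡ 4 * j + (13 + c)
    q+≡ c = trans (cong (_+ c) q≡) (ℕ.+-assoc (4 * j) 13 c)

    3q≡ : 3 * q ≡ 12 * j + 39
    3q≡ = trans (cong (3 *_) q≡) (scale 3 4 13)

    ≐0 : ι 0 ≐ 0 , 0
    ≐0 = form refl

    ≐1 : ι 1 ≐ 0 , 1
    ≐1 = form refl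

    h≐ : h ≐ 2 , 6
    h≐ = fraction 2 2 6 q∸1≡

    h′≐ : h′ ≐ 2 , 7
    h′≐ = fraction 2 2 7 (q+≡ 1)

    cₙ≐ : cₙ ≐ 1 , 3
    cₙ≐ = fraction 4 1 3 q∸1≡

    cₙ₊₁≐ : cₙ₊₁ ≐ 1 , 4
    cₙ₊₁≐ = fraction 4 1 4 (q+≡ 3)

    c₃ₙ≐ : c₃ₙ ≐ 3 , 9
    c₃ₙ≐ = fraction 4 3 9 (trans (cong (_∸ 3) 3q≡) (ℕ.+-∸-assoc (12 * j) {39} (s≤s (s≤s (s≤s z≤n)))))

    c₃ₙ₊₁≐ : c₃ₙ₊₁ ≐ 3 , 10
    c₃ₙ₊₁≐ = fraction 4 3 10 (trans (cong (_+ 1) 3q≡) (ℕ.+-assoc (12 * j) 39 1))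

    ⊕≐ : ∀ {x y a a′ b b′} → x ≐ a , b → y ≐ a′ , b′ → (x ⊕ y) ≐ (a + a′) , (b + b′)
    ⊕≐ {a = a} {a′} {b} {b′} (form refl) (form refl) =
      form (trans (sym (ι-homo-+ (a * j + b) (a′ * j + b′))) (cong ι (sym (split a a′ b b′))))

    same : ∀ {x y a b} k → y ≐ a , b → x ≐ (a + k * 4) , (b + k * 13) → x ≡ y
    same {a = a} {b} k (form refl) (form refl) =
      ι-cong (trans (cong (_% q) (split-multiple a k b)) ([m+kn]%n≡m%n (a * j + b) k q))

    -- Modulo q the difference is e * j + `suc f`, which is positive and, for e at most 4 and
    -- `suc f` below 13, less than 4 * j + 13 = q whatever j is. The room for the additive constant
    -- comes from n ≥ 3. On numerals both bounds are discharged by evaluation.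
    apart : ∀ {x y a b} e f k {_ : True (e ≤? 4)} {_ : True (suc f <? 13)} →
            x ≐ a , b → y ≐ (a + (e + k * 4)) , (b + (suc f + k * 13)) → x ≢ y
    apart {a = a} {b} e f k {e≤4} {f<12} (form refl) (form refl) = ι-≢ k
      (trans (split a (e + k * 4) b (suc f + k * 13))
        (cong (a * j + b +_) (trans (split-multiple e k (suc f)) (cong (_+ k * q) (ℕ.+-suc (e * j) f)))))
      (subst₂ _<_ (ℕ.+-suc (e * j) f) (sym q≡)
        (ℕ.+-mono-≤-< (ℕ.*-monoˡ-≤ j (toWitness e≤4)) (toWitness f<12)))

  0≢1 : ι {q} 0 ≢ ι 1
  0≢1 = apart 0 0 0 ≐0 ≐1

  0≢h : ι 0 ≢ h
  0≢h = apart 2 5 0 ≐0 h≐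

  0≢h′ : ι 0 ≢ h′
  0≢h′ = apart 2 6 0 ≐0 h′≐

  h≢h′ : h ≢ h′
  h≢h′ = apart 0 0 0 h≐ h′≐

  0≢cₙ : ι 0 ≢ cₙ
  0≢cₙ = apart 1 2 0 ≐0 cₙ≐

  0≢cₙ₊₁ : ι 0 ≢ cₙ₊₁
  0≢cₙ₊₁ = apart 1 3 0 ≐0 cₙ₊₁≐

  0≢c₃ₙ : ι 0 ≢ c₃ₙ
  0≢c₃ₙ = apart 3 8 0 ≐0 c₃ₙ≐

  0≢c₃ₙ₊₁ : ι 0 ≢ c₃ₙ₊₁
  0≢c₃ₙ₊₁ = apart 3 9 0 ≐0 c₃ₙ₊₁≐

  cₙ≢cₙ₊₁ : cₙ ≢ cₙ₊₁
  cₙ≢cₙ₊₁ = apart 0 0 0 cₙ≐ cₙ₊₁≐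

  cₙ≢h : cₙ ≢ h
  cₙ≢h = apart 1 2 0 cₙ≐ h≐

  cₙ≢h′ : cₙ ≢ h′
  cₙ≢h′ = apart 1 3 0 cₙ≐ h′≐

  cₙ≢c₃ₙ : cₙ ≢ c₃ₙ
  cₙ≢c₃ₙ = apart 2 5 0 cₙ≐ c₃ₙ≐

  cₙ≢c₃ₙ₊₁ : cₙ ≢ c₃ₙ₊₁
  cₙ≢c₃ₙ₊₁ = apart 2 6 0 cₙ≐ c₃ₙ₊₁≐

  cₙ₊₁≢h : cₙ₊₁ ≢ h
  cₙ₊₁≢h = apart 1 1 0 cₙ₊₁≐ h≐

  cₙ₊₁≢h′ : cₙ₊₁ ≢ h′
  cₙ₊₁≢h′ = apart 1 2 0 cₙ₊₁≐ h′≐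

  cₙ₊₁≢c₃ₙ : cₙ₊₁ ≢ c₃ₙ
  cₙ₊₁≢c₃ₙ = apart 2 4 0 cₙ₊₁≐ c₃ₙ≐

  cₙ₊₁≢c₃ₙ₊₁ : cₙ₊₁ ≢ c₃ₙ₊₁
  cₙ₊₁≢c₃ₙ₊₁ = apart 2 5 0 cₙ₊₁≐ c₃ₙ₊₁≐

  h≢c₃ₙ : h ≢ c₃ₙ
  h≢c₃ₙ = apart 1 2 0 h≐ c₃ₙ≐

  h≢c₃ₙ₊₁ : h ≢ c₃ₙ₊₁
  h≢c₃ₙ₊₁ = apart 1 3 0 h≐ c₃ₙ₊₁≐

  h′≢c₃ₙ : h′ ≢ c₃ₙ
  h′≢c₃ₙ = apart 1 1 0 h′≐ c₃ₙ≐

  h′≢c₃ₙ₊₁ : h′ ≢ c₃ₙ₊₁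
  h′≢c₃ₙ₊₁ = apart 1 2 0 h′≐ c₃ₙ₊₁≐

  c₃ₙ≢c₃ₙ₊₁ : c₃ₙ ≢ c₃ₙ₊₁
  c₃ₙ≢c₃ₙ₊₁ = apart 0 0 0 c₃ₙ≐ c₃ₙ₊₁≐

  -- Thus `h′` is minus `h`, and the two neighbours of y on the cycle G₁ are y + h and y + h′.
  h⊕h′≡0 : h ⊕ h′ ≡ ι 0
  h⊕h′≡0 = same 1 ≐0 (⊕≐ h≐ h′≐)

  -- With the next two equations: the cycle G₁ passes consecutively through `cₙ₊₁`, `c₃ₙ₊₁`, `cₙ`,
  -- `c₃ₙ`. Deleting the middle two, the elements of S, leaves a path from `c₃ₙ` round to `cₙ₊₁`,
  -- whose ends the exceptional edge of H₁ joins.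
  cₙ⊕h≡c₃ₙ : cₙ ⊕ h ≡ c₃ₙ
  cₙ⊕h≡c₃ₙ = same 0 c₃ₙ≐ (⊕≐ cₙ≐ h≐)

  cₙ₊₁⊕h≡c₃ₙ₊₁ : cₙ₊₁ ⊕ h ≡ c₃ₙ₊₁
  cₙ₊₁⊕h≡c₃ₙ₊₁ = same 0 c₃ₙ₊₁≐ (⊕≐ cₙ₊₁≐ h≐)

  c₃ₙ₊₁⊕h≡cₙ : c₃ₙ₊₁ ⊕ h ≡ cₙ
  c₃ₙ₊₁⊕h≡cₙ = same 1 cₙ≐ (⊕≐ c₃ₙ₊₁≐ h≐)

  cₙ≢2h : cₙ ≢ h ⊕ h
  cₙ≢2h = apart 3 8 0 cₙ≐ (⊕≐ h≐ h≐)

  0≢3h : ι 0 ≢ h ⊕ h ⊕ h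
  0≢3h = apart 2 4 1 ≐0 (⊕≐ (⊕≐ h≐ h≐) h≐)

  0≢4h : ι 0 ≢ h ⊕ h ⊕ h ⊕ h
  0≢4h = apart 4 10 1 ≐0 (⊕≐ (⊕≐ (⊕≐ h≐ h≐) h≐) h≐)

  -- After the jump from `cₙ₊₁` to `c₃ₙ`, one, two or three further steps do not lead back; this
  -- excludes the short circuits of H₁ that use the jump.
  cₙ₊₁≢c₃ₙ⊕h : cₙ₊₁ ≢ c₃ₙ ⊕ h
  cₙ₊₁≢c₃ₙ⊕h = apart 4 10 0 cₙ₊₁≐ (⊕≐ c₃ₙ≐ h≐)

  cₙ₊₁≢c₃ₙ⊕2h : cₙ₊₁ ≢ c₃ₙ ⊕ h ⊕ h
  cₙ₊₁≢c₃ₙ⊕2h = apart 2 3 1 cₙ₊₁≐ (⊕≐ (⊕≐ c₃ₙ≐ h≐) h≐)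

  cₙ₊₁≢c₃ₙ⊕3h : cₙ₊₁ ≢ c₃ₙ ⊕ h ⊕ h ⊕ h
  cₙ₊₁≢c₃ₙ⊕3h = apart 4 9 1 cₙ₊₁≐ (⊕≐ (⊕≐ (⊕≐ c₃ₙ≐ h≐) h≐) h≐)

  cancel-shift : ∀ {a b c : Fin q} → a ⊕ b ≡ a ⊕ c → b ≡ c
  cancel-shift {a} {b} {c} = +-cancelˡ a b c

  ⊕-fixed⇒0 : ∀ {a b : Fin q} → a ≡ a ⊕ b → ι 0 ≡ b
  ⊕-fixed⇒0 {a} e = cancel-shift (trans (+-identityʳ a) e)

  shift-back : ∀ {y z : Fin q} → y ≡ z ⊕ h → z ≡ y ⊕ h′
  shift-back {z = z} refl = sym (trans (+-assoc z h h′) (trans (cong (z ⊕_) h⊕h′≡0) (+-identityʳ z)))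

  shift-forth : ∀ {y z : Fin q} → z ≡ y ⊕ h′ → y ≡ z ⊕ h
  shift-forth {y} refl = sym (trans (+-assoc y h′ h)
    (trans (cong (y ⊕_) (trans (+-comm h′ h) h⊕h′≡0)) (+-identityʳ y)))

  infix 4 _⇝_ _⇝ʰ_ _⇝₂_

  _⇝_ : Rel (Fin q) 0ℓ
  a ⇝ b = b ≡ a ⊕ h

  -- The cycle H₁ runs along the steps of G₁, except that it jumps from (q+3)/4 to (3q-3)/4.
  _⇝ʰ_ : Rel (Fin q) 0ℓ
  a ⇝ʰ b = (a ≢ cₙ₊₁ × a ⇝ b) ⊎ (a ≡ cₙ₊₁ × b ≡ c₃ₙ)

  -- The tree G₂ is directed towards its root 0.
  _⇝₂_ : Rel (Fin q) 0ℓ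
  a ⇝₂ b = G₂-edge b a

  ⇝-3steps : ∀ {a b c d} → a ⇝ b → b ⇝ c → c ⇝ d → d ≡ a ⊕ (h ⊕ h ⊕ h)
  ⇝-3steps {a} refl refl refl = trans (cong (_⊕ h) (+-assoc a h h)) (+-assoc a (h ⊕ h) h)

  ⇝-no-circuit₃ : ∀ {a b c} → a ⇝ b → b ⇝ c → c ⇝ a → ⊥
  ⇝-no-circuit₃ ab bc ca = 0≢3h (⊕-fixed⇒0 (⇝-3steps ab bc ca))

  ⇝-no-circuit₄ : ∀ {a b c d} → a ⇝ b → b ⇝ c → c ⇝ d → d ⇝ a → ⊥
  ⇝-no-circuit₄ {a} ab bc cd da = 0≢4h (⊕-fixed⇒0
    (trans da (trans (cong (_⊕ h) (⇝-3steps ab bc cd)) (+-assoc a (h ⊕ h ⊕ h) h))))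

  ⇝ʰ-functional : ∀ {a b c} → a ⇝ʰ b → a ⇝ʰ c → b ≡ c
  ⇝ʰ-functional (inj₁ (_ , refl)) (inj₁ (_ , refl)) = refl
  ⇝ʰ-functional (inj₁ (a≢ , _))   (inj₂ (a≡ , _))   = ⊥-elim (a≢ a≡)
  ⇝ʰ-functional (inj₂ (a≡ , _))   (inj₁ (a≢ , _))   = ⊥-elim (a≢ a≡)
  ⇝ʰ-functional (inj₂ (_ , refl)) (inj₂ (_ , refl)) = refl

  ⇝ʰ-jump : ∀ {b} → cₙ₊₁ ⇝ʰ b → b ≡ c₃ₙ
  ⇝ʰ-jump (inj₁ (c≢ , _)) = ⊥-elim (c≢ refl)
  ⇝ʰ-jump (inj₂ (_ , b≡)) = b≡

  ⇝ʰ-step : ∀ {a b} → cₙ₊₁ ≢ a → a ⇝ʰ b → b ≡ a ⊕ h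
  ⇝ʰ-step c≢a (inj₁ (_ , b≡)) = b≡
  ⇝ʰ-step c≢a (inj₂ (a≡ , _)) = ⊥-elim (c≢a (sym a≡))

  -- After the jump every vertex reached differs from `cₙ₊₁`, so all remaining moves are forced to
  -- be ordinary steps and the position is known exactly. Any circuit with a jump can be rotated to
  -- start with it.
  jump-no-circuit₃ : ∀ {b c} → cₙ₊₁ ⇝ʰ b → b ⇝ʰ c → c ⇝ʰ cₙ₊₁ → ⊥
  jump-no-circuit₃ jb bc cj
    with refl ← ⇝ʰ-jump jb
    with refl ← ⇝ʰ-step cₙ₊₁≢c₃ₙ bc = cₙ₊₁≢c₃ₙ⊕2h (⇝ʰ-step cₙ₊₁≢c₃ₙ⊕h cj)

  jump-no-circuit₄ : ∀ {b c d} → cₙ₊₁ ⇝ʰ b → b ⇝ʰ c → c ⇝ʰ d → d ⇝ʰ cₙ₊₁ → ⊥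
  jump-no-circuit₄ jb bc cd dj
    with refl ← ⇝ʰ-jump jb
    with refl ← ⇝ʰ-step cₙ₊₁≢c₃ₙ bc
    with refl ← ⇝ʰ-step cₙ₊₁≢c₃ₙ⊕h cd = cₙ₊₁≢c₃ₙ⊕3h (⇝ʰ-step cₙ₊₁≢c₃ₙ⊕2h dj)

  ⇝ʰ-no-circuit₃ : ∀ {a b c} → a ⇝ʰ b → b ⇝ʰ c → c ⇝ʰ a → ⊥
  ⇝ʰ-no-circuit₃ ab@(inj₂ (refl , _)) bc ca = jump-no-circuit₃ ab bc ca
  ⇝ʰ-no-circuit₃ ab bc@(inj₂ (refl , _)) ca = jump-no-circuit₃ bc ca ab
  ⇝ʰ-no-circuit₃ ab bc ca@(inj₂ (refl , _)) = jump-no-circuit₃ ca ab bc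
  ⇝ʰ-no-circuit₃ (inj₁ (_ , ab)) (inj₁ (_ , bc)) (inj₁ (_ , ca)) = ⇝-no-circuit₃ ab bc ca

  ⇝ʰ-no-circuit₄ : ∀ {a b c d} → a ⇝ʰ b → b ⇝ʰ c → c ⇝ʰ d → d ⇝ʰ a → ⊥
  ⇝ʰ-no-circuit₄ ab@(inj₂ (refl , _)) bc cd da = jump-no-circuit₄ ab bc cd da
  ⇝ʰ-no-circuit₄ ab bc@(inj₂ (refl , _)) cd da = jump-no-circuit₄ bc cd da ab
  ⇝ʰ-no-circuit₄ ab bc cd@(inj₂ (refl , _)) da = jump-no-circuit₄ cd da ab bc
  ⇝ʰ-no-circuit₄ ab bc cd da@(inj₂ (refl , _)) = jump-no-circuit₄ da ab bc cd
  ⇝ʰ-no-circuit₄ (inj₁ (_ , ab)) (inj₁ (_ , bc)) (inj₁ (_ , cd)) (inj₁ (_ , da)) =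
    ⇝-no-circuit₄ ab bc cd da

  ⇝₂-functional : ∀ {a b c} → a ⇝₂ b → a ⇝₂ c → b ≡ c
  ⇝₂-functional (inj₁ (refl , _))               (inj₁ (refl , _))               = refl
  ⇝₂-functional (inj₁ (_ , _ , a≢h , _))        (inj₂ (inj₁ (_ , a≡h)))         = ⊥-elim (a≢h a≡h)
  ⇝₂-functional (inj₁ (_ , _ , _ , a≢h′))       (inj₂ (inj₂ (_ , a≡h′)))        = ⊥-elim (a≢h′ a≡h′)
  ⇝₂-functional (inj₂ (inj₁ (_ , a≡h)))         (inj₁ (_ , _ , a≢h , _))        = ⊥-elim (a≢h a≡h)
  ⇝₂-functional (inj₂ (inj₁ (refl , _)))        (inj₂ (inj₁ (refl , _)))        = refl
  ⇝₂-functional (inj₂ (inj₁ (_ , refl)))        (inj₂ (inj₂ (_ , h≡h′)))        = ⊥-elim (h≢h′ h≡h′)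
  ⇝₂-functional (inj₂ (inj₂ (_ , a≡h′)))        (inj₁ (_ , _ , _ , a≢h′))       = ⊥-elim (a≢h′ a≡h′)
  ⇝₂-functional (inj₂ (inj₂ (_ , refl)))        (inj₂ (inj₁ (_ , h′≡h)))        = ⊥-elim (h≢h′ (sym h′≡h))
  ⇝₂-functional (inj₂ (inj₂ (refl , _)))        (inj₂ (inj₂ (refl , _)))        = refl

  root-is-sink : ∀ {b} → ¬ ι 0 ⇝₂ b
  root-is-sink (inj₁ (_ , 0≢0 , _))      = 0≢0 refl
  root-is-sink (inj₂ (inj₁ (_ , 0≡h)))   = 0≢h 0≡h
  root-is-sink (inj₂ (inj₂ (_ , 0≡h′)))  = 0≢h′ 0≡h′

  -- Only `h` and `h′` have a parent other than the root, and neither of them has children.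
  two-steps-to-root : ∀ {a b c} → a ⇝₂ b → b ⇝₂ c → c ≡ ι 0
  two-steps-to-root ab                      (inj₁ (c≡0 , _))       = c≡0
  two-steps-to-root (inj₁ (refl , _))       bc@(inj₂ _)            = ⊥-elim (root-is-sink bc)
  two-steps-to-root (inj₂ (inj₁ (refl , _))) (inj₂ (inj₁ (_ , e))) = ⊥-elim (cₙ≢h e)
  two-steps-to-root (inj₂ (inj₁ (refl , _))) (inj₂ (inj₂ (_ , e))) = ⊥-elim (cₙ≢h′ e)
  two-steps-to-root (inj₂ (inj₂ (refl , _))) (inj₂ (inj₁ (_ , e))) = ⊥-elim (h≢c₃ₙ₊₁ (sym e))
  two-steps-to-root (inj₂ (inj₂ (refl , _))) (inj₂ (inj₂ (_ , e))) = ⊥-elim (h′≢c₃ₙ₊₁ (sym e))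

  no-three-steps : ∀ {a b c d} → a ⇝₂ b → b ⇝₂ c → ¬ c ⇝₂ d
  no-three-steps ab bc cd with refl ← two-steps-to-root ab bc = root-is-sink cd

  G₁-squarefree : Squarefree (λ a b → a ⇝ b ⊎ b ⇝ a)
  G₁-squarefree = oriented⇒squarefree (λ { refl refl → refl }) ⇝-no-circuit₃ ⇝-no-circuit₄

  H₁-squarefree : Squarefree (λ a b → a ⇝ʰ b ⊎ b ⇝ʰ a)
  H₁-squarefree = oriented⇒squarefree ⇝ʰ-functional ⇝ʰ-no-circuit₃ ⇝ʰ-no-circuit₄

  G₂-squarefree : Squarefree (λ a b → a ⇝₂ b ⊎ b ⇝₂ a)
  G₂-squarefree = oriented⇒squarefree ⇝₂-functional (λ ab bc ca → no-three-steps ab bc ca)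
                                      (λ ab bc cd _ → no-three-steps ab bc cd)

  -- The only candidates for differences ±h at the root are the edges from 0 to `h` and `h′`,
  -- precisely the two left out of the star; the two edges that replace them have differences
  -- ±(q-1)/4.
  G₁⊥G₂ : ∀ {a b} → a ⇝ b → ¬ (a ⇝₂ b ⊎ b ⇝₂ a)
  G₁⊥G₂ a→b (inj₁ (inj₁ (refl , _ , _ , a≢h′))) =
    a≢h′ (trans (shift-back a→b) (+-identityˡ h′))
  G₁⊥G₂ a→b (inj₁ (inj₂ (inj₁ (refl , refl)))) = cₙ≢2h a→b
  G₁⊥G₂ a→b (inj₁ (inj₂ (inj₂ (refl , refl)))) =
    0≢c₃ₙ₊₁ (trans (sym (trans (+-comm h′ h) h⊕h′≡0)) (sym a→b))
  G₁⊥G₂ a→b (inj₂ (inj₁ (refl , _ , b≢h , _))) = b≢h (trans a→b (+-identityˡ h))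
  G₁⊥G₂ a→b (inj₂ (inj₂ (inj₁ (refl , refl)))) =
    0≢cₙ (sym (+-cancelʳ h _ _ (trans (sym a→b) (sym (+-identityˡ h)))))
  G₁⊥G₂ a→b (inj₂ (inj₂ (inj₂ (refl , refl)))) = cₙ≢h′ (sym (trans a→b c₃ₙ₊₁⊕h≡cₙ))

  jump⊥G₂ : ¬ (cₙ₊₁ ⇝₂ c₃ₙ ⊎ c₃ₙ ⇝₂ cₙ₊₁)
  jump⊥G₂ (inj₁ (inj₁ (e , _)))        = 0≢c₃ₙ (sym e)
  jump⊥G₂ (inj₁ (inj₂ (inj₁ (_ , e)))) = cₙ₊₁≢h e
  jump⊥G₂ (inj₁ (inj₂ (inj₂ (_ , e)))) = cₙ₊₁≢h′ e
  jump⊥G₂ (inj₂ (inj₁ (e , _)))        = 0≢cₙ₊₁ (sym e)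
  jump⊥G₂ (inj₂ (inj₂ (inj₁ (_ , e)))) = h≢c₃ₙ (sym e)
  jump⊥G₂ (inj₂ (inj₂ (inj₂ (_ , e)))) = h′≢c₃ₙ (sym e)

  H₁-edge⇒⇝ʰ : ∀ {a b} → H₁-edge a b ⊎ H₁-edge b a → a ⇝ʰ b ⊎ b ⇝ʰ a
  H₁-edge⇒⇝ʰ (inj₁ (inj₁ ((_ , a≢) , e))) = inj₁ (inj₁ (a≢ , e))
  -- The exceptional pair is listed from `c₃ₙ` to `cₙ₊₁`, against the direction in which the cycle
  -- is run through.
  H₁-edge⇒⇝ʰ (inj₁ (inj₂ (a≡ , b≡)))      = inj₂ (inj₂ (b≡ , a≡))
  H₁-edge⇒⇝ʰ (inj₂ (inj₁ ((_ , b≢) , e))) = inj₂ (inj₁ (b≢ , e))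
  H₁-edge⇒⇝ʰ (inj₂ (inj₂ (b≡ , a≡)))      = inj₁ (inj₂ (a≡ , b≡))

-- Squarefreeness of an amalgam over a partial linear space

module _ {P L : Set} (_∙_ : P → L → Set) (R₀ : Rel P 0ℓ) (R₁ : Rel L 0ℓ) where

  Amalgamated : Rel (P ⊎ L) 0ℓ
  Amalgamated (inj₁ p) (inj₁ p′) = R₀ p p′
  Amalgamated (inj₁ p) (inj₂ l)  = p ∙ l
  Amalgamated (inj₂ l) (inj₁ p)  = p ∙ l
  Amalgamated (inj₂ l) (inj₂ l′) = R₁ l l′

module _ {P L X Y : Set} (classₚ : P → X) (classₗ : L → Y)
  {_∙_ : P → L → Set} {R₀ : Rel P 0ℓ} {R₁ : Rel L 0ℓ}
  (same₀ : ∀ {p p′} → R₀ p p′ → classₚ p ≡ classₚ p′)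
  (same₁ : ∀ {l l′} → R₁ l l′ → classₗ l ≡ classₗ l′)
  (unique-point : ∀ {p p′ l} → classₚ p ≡ classₚ p′ → p ∙ l → p′ ∙ l → p ≡ p′)
  (unique-line : ∀ {p l l′} → classₗ l ≡ classₗ l′ → p ∙ l → p ∙ l′ → l ≡ l′)
  (linear : ∀ {p p′ l l′} → p ≢ p′ → l ≢ l′ → p ∙ l → p′ ∙ l → p ∙ l′ → p′ ∙ l′ → ⊥)
  (sf₀ : Squarefree R₀) (sf₁ : Squarefree R₁) (sym₁ : Symmetric R₁)
  (cross : ∀ {p p′ l l′} → p ∙ l → p′ ∙ l′ → R₀ p p′ → R₁ l l′ → ⊥)
  where

  private
    irreflexive : ∀ {V} {_~_ : Rel V 0ℓ} → Squarefree _~_ → ∀ {a b} → a ~ b → a ≢ b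
    irreflexive sf ab refl = no-triangle sf ab ab ab

    triangle-ppl : ∀ {p p′ l} → R₀ p p′ → p ∙ l → p′ ∙ l → ⊥
    triangle-ppl r pl p′l = irreflexive sf₀ r (unique-point (same₀ r) pl p′l)

    triangle-pll : ∀ {p l l′} → R₁ l l′ → p ∙ l → p ∙ l′ → ⊥
    triangle-pll r pl pl′ = irreflexive sf₁ r (unique-line (same₁ r) pl pl′)

    square-pppl : ∀ {p p′ p″ l} → p ≢ p″ → R₀ p p′ → R₀ p′ p″ → p ∙ l → p″ ∙ l → ⊥
    square-pppl p≢ r r′ pl p″l = p≢ (unique-point (trans (same₀ r) (same₀ r′)) pl p″l)

    square-plll : ∀ {p l l′ l″} → l ≢ l″ → R₁ l l′ → R₁ l′ l″ → p ∙ l → p ∙ l″ → ⊥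
    square-plll l≢ r r′ pl pl″ = l≢ (unique-line (trans (same₁ r) (same₁ r′)) pl pl″)

  -- A mixed triangle, or a square with exactly three corners on one side, contains two distinct
  -- vertices of one class with a common neighbour on the other side. Alternating squares contradict
  -- `linear`, so `cross` is called on only when each side has two adjacent corners.
  amalgamated-squarefree : Squarefree (Amalgamated _∙_ R₀ R₁)
  amalgamated-squarefree = record
    { no-triangle = λ {a} {b} {c} → triangle {a} {b} {c}
    ; no-square   = λ {a} {b} {c} {d} → square {a} {b} {c} {d}
    }
    where
    _~_ = Amalgamated _∙_ R₀ R₁

    triangle : ∀ {a b c} → a ~ b → b ~ c → c ~ a → ⊥
    triangle {inj₁ _} {inj₁ _} {inj₁ _} ab bc ca = no-triangle sf₀ ab bc ca
    triangle {inj₁ _} {inj₁ _} {inj₂ _} ab bc ca = triangle-ppl ab ca bc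
    triangle {inj₁ _} {inj₂ _} {inj₁ _} ab bc ca = triangle-ppl ca bc ab
    triangle {inj₂ _} {inj₁ _} {inj₁ _} ab bc ca = triangle-ppl bc ab ca
    triangle {inj₁ _} {inj₂ _} {inj₂ _} ab bc ca = triangle-pll bc ab ca
    triangle {inj₂ _} {inj₁ _} {inj₂ _} ab bc ca = triangle-pll ca bc ab
    triangle {inj₂ _} {inj₂ _} {inj₁ _} ab bc ca = triangle-pll ab ca bc
    triangle {inj₂ _} {inj₂ _} {inj₂ _} ab bc ca = no-triangle sf₁ ab bc ca

    square : ∀ {a b c d} → a ≢ c → b ≢ d → a ~ b → b ~ c → c ~ d → d ~ a → ⊥
    square {inj₁ _} {inj₁ _} {inj₁ _} {inj₁ _} a≢c b≢d ab bc cd da =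
      no-square sf₀ (a≢c ∘ cong inj₁) (b≢d ∘ cong inj₁) ab bc cd da
    square {inj₂ _} {inj₂ _} {inj₂ _} {inj₂ _} a≢c b≢d ab bc cd da =
      no-square sf₁ (a≢c ∘ cong inj₂) (b≢d ∘ cong inj₂) ab bc cd da
    square {inj₁ _} {inj₁ _} {inj₁ _} {inj₂ _} a≢c b≢d ab bc cd da =
      square-pppl (a≢c ∘ cong inj₁) ab bc da cd
    square {inj₁ _} {inj₁ _} {inj₂ _} {inj₁ _} a≢c b≢d ab bc cd da =
      square-pppl (b≢d ∘ cong inj₁ ∘ sym) da ab cd bc
    square {inj₁ _} {inj₂ _} {inj₁ _} {inj₁ _} a≢c b≢d ab bc cd da =
      square-pppl (a≢c ∘ cong inj₁ ∘ sym) cd da bc ab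
    square {inj₂ _} {inj₁ _} {inj₁ _} {inj₁ _} a≢c b≢d ab bc cd da =
      square-pppl (b≢d ∘ cong inj₁) bc cd ab da
    square {inj₂ _} {inj₂ _} {inj₂ _} {inj₁ _} a≢c b≢d ab bc cd da =
      square-plll (a≢c ∘ cong inj₂) ab bc da cd
    square {inj₂ _} {inj₂ _} {inj₁ _} {inj₂ _} a≢c b≢d ab bc cd da =
      square-plll (b≢d ∘ cong inj₂ ∘ sym) da ab cd bc
    square {inj₂ _} {inj₁ _} {inj₂ _} {inj₂ _} a≢c b≢d ab bc cd da =
      square-plll (a≢c ∘ cong inj₂ ∘ sym) cd da bc ab
    square {inj₁ _} {inj₂ _} {inj₂ _} {inj₂ _} a≢c b≢d ab bc cd da =
      square-plll (b≢d ∘ cong inj₂) bc cd ab da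
    square {inj₁ a} {inj₂ _} {inj₁ c} {inj₂ _} a≢c b≢d ab bc cd da =
      linear (a≢c ∘ cong inj₁) (b≢d ∘ cong inj₂) ab bc da cd
    square {inj₂ _} {inj₁ _} {inj₂ _} {inj₁ _} a≢c b≢d ab bc cd da =
      linear (b≢d ∘ cong inj₁) (a≢c ∘ cong inj₂) ab da bc cd
    -- Going round the square runs through the two inner edges in opposite directions, while `cross`
    -- pairs their ends by incidence; `sym₁` reverses one of them.
    square {inj₁ _} {inj₁ _} {inj₂ _} {inj₂ _} _ _ ab bc cd da = cross da bc ab (sym₁ cd)
    square {inj₁ _} {inj₂ _} {inj₂ _} {inj₁ _} _ _ ab bc cd da = cross cd ab da (sym₁ bc)
    square {inj₂ _} {inj₂ _} {inj₁ _} {inj₁ _} _ _ ab bc cd da = cross bc da cd (sym₁ ab)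
    square {inj₂ _} {inj₁ _} {inj₁ _} {inj₂ _} _ _ ab bc cd da = cross ab cd bc (sym₁ da)

class-squarefree : ∀ {X Y : Set} {E : X → Rel Y 0ℓ} → (∀ x → Squarefree (E x)) →
  Squarefree (λ (p p′ : X × Y) → proj₁ p ≡ proj₁ p′ × E (proj₁ p) (proj₂ p) (proj₂ p′))
class-squarefree sf = record
  { no-triangle = λ { (refl , ab) (refl , bc) (refl , ca) → no-triangle (sf _) ab bc ca }
  ; no-square   = λ { a≢c b≢d (refl , ab) (refl , bc) (refl , cd) (refl , da) →
      no-square (sf _) (a≢c ∘ cong (_ ,_)) (b≢d ∘ cong (_ ,_)) ab bc cd da }
  }

-- Counting lemmas and the numerical identities

count-is : ∀ {q} {P : Pred (Fin q) 0ℓ} (P? : Decidable P) {es} → Unique es →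
  (∀ {z} → P z → z List.∈ es) → (∀ {z} → z List.∈ es → P z) → length (filter P? (allFin q)) ≡ length es
count-is {q} P? ue to from = unique-length (Unique.filter⁺ P? (Unique.allFin⁺ q)) ue
  (λ z∈ → to (proj₂ (∈-filter⁻ P? {xs = allFin q} z∈)))
  (λ z∈ → ∈-filter⁺ P? (∈-allFin _) (from z∈))

length-allFin : ∀ q → length (allFin q) ≡ q
length-allFin q = List.length-tabulate id

length-cartesianProduct : ∀ {A B : Set} (xs : List A) (ys : List B) →
  length (cartesianProduct xs ys) ≡ length xs * length ys
length-cartesianProduct []       ys = refl
length-cartesianProduct (x ∷ xs) ys = trans (List.length-++ (map (x ,_) ys))
  (cong₂ _+_ (List.length-map (x ,_) ys) (length-cartesianProduct xs ys))

-- Here t = q - 3 is the degree of the root of G₂, so the large degree splits into the points and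
-- the further lines adjacent to a line of intercept 0.
large-degree : ∀ {q t} → q ≡ t + 3 → 2 * (q + 1) ∸ 5 ≡ q + t
large-degree {q} {t} q≡ = begin
  2 * (q + 1) ∸ 5         ≡⟨ cong (_∸ 5) (double q) ⟩
  q + q + 2 ∸ 5           ≡⟨ cong (λ p → q + p + 2 ∸ 5) q≡ ⟩
  q + (t + 3) + 2 ∸ 5     ≡⟨ cong (_∸ 5) (reassoc q t) ⟩
  q + t + 5 ∸ 5           ≡⟨ ℕ.m+n∸n≡m (q + t) 5 ⟩
  q + t                   ∎
  where
  open ≡-Reasoning
  double : ∀ q → 2 * (q + 1) ≡ q + q + 2
  double = solve-∀
  reassoc : ∀ q t → q + (t + 3) + 2 ≡ q + t + 5
  reassoc = solve-∀

-- On the left is the order of B_q; 2 + q counts the two deleted points and the deleted block of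
-- lines.
moore-number : ∀ {q t} → q ≡ t + 3 → q * q + q * q ≡ (q + 1) * (q + t) + 1 + (2 + q)
moore-number {q} {t} q≡ = begin
  q * q + q * q                         ≡⟨ cong (λ p → q * q + q * p) q≡ ⟩
  q * q + q * (t + 3)                   ≡⟨ split q t ⟩
  q * q + q * (t + 2) + q               ≡⟨ cong (q * q + q * (t + 2) +_) q≡ ⟩
  q * q + q * (t + 2) + (t + 3)         ≡⟨ collect q t ⟩
  (q + 1) * (q + t) + 1 + (2 + q)       ∎
  where
  open ≡-Reasoning
  split : ∀ q t → q * q + q * (t + 3) ≡ q * q + q * (t + 2) + q
  split = solve-∀
  collect : ∀ q t → q * q + q * (t + 2) + (t + 3) ≡ (q + 1) * (q + t) + 1 + (2 + q)
  collect = solve-∀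

-- The amalgam has no triangles and no squares

module AmalgamGraph (q : ℕ) .{{_ : NonZero q}} (j : ℕ) (q≡ : q ≡ 4 * j + 13)
                    (pr : Prime q) (α : Fin q) (α≢0 : α ≢ ι 0) where

  open Field q
  open Blocks q j q≡

  B* : Graph [ v ∈ BVertex q ∣ Kept α S T 0 1 v ]
  B* = amalgam α S T 0 1 H₁ H₂ G₁ G₂

  R₀ R₁ : Rel (Fin q × Fin q) 0ℓ
  R₀ = BlockAdj α S T 0 1 H₁ G₁ 0
  R₁ = BlockAdj α S T 0 1 H₂ G₂ 1

  ∈S⁻ : ∀ {y} → y ∈ S → y ≡ cₙ ⊎ y ≡ c₃ₙ₊₁
  ∈S⁻ y∈S = Sum.map (x∈⁅y⁆⇒x≡y _) (x∈⁅y⁆⇒x≡y _) (x∈p∪q⁻ _ _ y∈S)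

  ∉S : ∀ {y} → y ≢ cₙ → y ≢ c₃ₙ₊₁ → y ∉ S
  ∉S y≢ y≢′ y∈S = Sum.[ y≢ , y≢′ ] (∈S⁻ y∈S)

  cₙ∈S : cₙ ∈ S
  cₙ∈S = x∈p∪q⁺ (inj₁ (x∈⁅x⁆ _))

  c₃ₙ₊₁∈S : c₃ₙ₊₁ ∈ S
  c₃ₙ₊₁∈S = x∈p∪q⁺ (inj₂ (x∈⁅x⁆ _))

  a : Fin q
  a = α ↑ (q ∸ 2)

  -- The block L_0 therefore survives, and its line of intercept 0 serves as a vertex of large
  -- degree and as a corner of the pentagon.
  a≢0 : a ≢ ι 0
  a≢0 = ↑-≢0 pr (q ∸ 2) (0≢1 ∘ sym) α≢0

  a∈U₁ : a ∈ U α 1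
  a∈U₁ = x∈p∪q⁺ (inj₁ (x∈⁅x⁆ a))

  ∉U₁ : ∀ {m} → m ≢ a → m ∉ U α 1
  ∉U₁ m≢a m∈ with x∈p∪q⁻ _ _ m∈
  ... | inj₁ m∈a = m≢a (x∈⁅y⁆⇒x≡y a m∈a)
  ... | inj₂ m∈∅ = ∉⊥ m∈∅

  incident-at-0 : ∀ {m b : Fin q} → m ⊗ ι 0 ⊕ b ≡ b
  incident-at-0 {m} {b} = trans (cong (_⊕ b) (zeroʳ m)) (+-identityˡ b)

  R₀-at-0 : ∀ {x y y′} → x ≡ ι 0 → R₀ (x , y) (x , y′) → y ⇝ʰ y′ ⊎ y′ ⇝ʰ y
  R₀-at-0 _   (_ , inj₁ (_ , adj _ _ (_ , e))) = H₁-edge⇒⇝ʰ e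
  R₀-at-0 x≡0 (_ , inj₂ ((x≢0 , _) , _))       = ⊥-elim (x≢0 x≡0)

  R₀-off-0 : ∀ {x y y′} → x ≢ ι 0 → R₀ (x , y) (x , y′) → y ⇝ y′ ⊎ y′ ⇝ y
  R₀-off-0 x≢0 (_ , inj₁ (x≡0 , _))     = ⊥-elim (x≢0 x≡0)
  R₀-off-0 _   (_ , inj₂ (_ , (_ , e))) = e

  -- As T is empty, `H₂` is a copy of `G₂`, and the line blocks need no separate treatment of slope
  -- 0.
  R₁⇒G₂ : ∀ {m b b′} → R₁ (m , b) (m , b′) → Adj G₂ b b′
  R₁⇒G₂ (_ , inj₁ (_ , adj _ _ g)) = g
  R₁⇒G₂ (_ , inj₂ (_ , g))         = g

  G₂⇒R₁ : ∀ {m b b′} → m ∉ U α 1 → Adj G₂ b b′ → R₁ (m , b) (m , b′)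
  G₂⇒R₁ {m} m∉U g with m Fin.≟ ι 0
  ... | yes m≡0 = refl , inj₁ (m≡0 , adj ∉⊥ ∉⊥ g)
  ... | no m≢0  = refl , inj₂ ((m≢0 , m∉U) , g)

  R₀-squarefree : Squarefree R₀
  R₀-squarefree = squarefree-⊆ (λ { (x≡x′ , e) → x≡x′ , refl , e }) (class-squarefree block)
    where
    block : ∀ x → Squarefree (λ y y′ → R₀ (x , y) (x , y′))
    block x with x Fin.≟ ι 0
    ... | yes x≡0 = squarefree-⊆ (R₀-at-0 x≡0) H₁-squarefree
    ... | no x≢0  = squarefree-⊆ (R₀-off-0 x≢0) G₁-squarefree

  R₁-squarefree : Squarefree R₁
  R₁-squarefree = squarefree-⊆ (λ { (m≡m′ , e) → m≡m′ , refl , e }) (class-squarefree λ m →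
    squarefree-⊆ (λ r → swap (proj₂ (R₁⇒G₂ {m} r))) G₂-squarefree)

  infix 4 _∙_
  _∙_ : Rel (Fin q × Fin q) 0ℓ
  (x , y) ∙ (m , b) = y ≡ m ⊗ x ⊕ b

  R₀⊥R₁ : ∀ {p p′ l l′} → p ∙ l → p′ ∙ l′ → R₀ p p′ → R₁ l l′ → ⊥
  R₀⊥R₁ {x , y} {.x , y′} {m , b} {.m , b′} y≡ y′≡ r₀@(refl , _) r₁@(refl , _) = by-class (x Fin.≟ ι 0)
    where
    g₂ : b ⇝₂ b′ ⊎ b′ ⇝₂ b
    g₂ = swap (proj₂ (R₁⇒G₂ {m} r₁))

    -- Both incidences contain the same term m x, which cancels: a step between the ordinates is the
    -- same step between the intercepts.
    project : ∀ {y y′ b b′} → y ≡ m ⊗ x ⊕ b → y′ ≡ m ⊗ x ⊕ b′ → y ⇝ y′ → b ⇝ b′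
    project {b = b} refl refl y→y′ = cancel-shift (trans y→y′ (+-assoc (m ⊗ x) b h))

    steps : ¬ (y ⇝ y′ ⊎ y′ ⇝ y)
    steps (inj₁ s) = G₁⊥G₂ (project y≡ y′≡ s) g₂
    steps (inj₂ s) = G₁⊥G₂ (project y′≡ y≡ s) (swap g₂)

    -- For the exceptional edge comparing differences is not enough: its difference (q-3)/2 does
    -- occur in G₂, at the edge from 0. But at x = 0 ordinates are intercepts, so b and b′ would be
    -- the very ends of that edge.
    at-0 : x ≡ ι 0 → ∀ {y b} → y ≡ m ⊗ x ⊕ b → y ≡ b
    at-0 refl e = trans e (incident-at-0 {m})

    by-class : Dec (x ≡ ι 0) → ⊥
    by-class (no x≢0)  = steps (R₀-off-0 x≢0 r₀)
    by-class (yes x≡0) with R₀-at-0 x≡0 r₀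
    ... | inj₁ (inj₁ (_ , s)) = steps (inj₁ s)
    ... | inj₂ (inj₁ (_ , s)) = steps (inj₂ s)
    ... | inj₁ (inj₂ (y≡c , y′≡c)) with refl ← trans (sym (at-0 x≡0 y≡)) y≡c
                                   | refl ← trans (sym (at-0 x≡0 y′≡)) y′≡c = jump⊥G₂ g₂
    ... | inj₂ (inj₂ (y′≡c , y≡c)) with refl ← trans (sym (at-0 x≡0 y≡)) y≡c
                                   | refl ← trans (sym (at-0 x≡0 y′≡)) y′≡c = jump⊥G₂ (swap g₂)

  B*-squarefree : Squarefree (Adj B*)
  B*-squarefree = record
    { no-triangle = λ {u} {v} {w} uv vw wu →
        no-triangle sf {value u} {value v} {value w} (to u v uv) (to v w vw) (to w u wu)
    ; no-square   = λ {t} {u} {v} {w} t≢v u≢w tu uv vw wt →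
        no-square sf {value t} {value u} {value v} {value w} (t≢v ∘ value-injective) (u≢w ∘ value-injective)
          (to t u tu) (to u v uv) (to v w vw) (to w t wt)
    }
    where
    unique-point : ∀ {p p′ l} → proj₁ p ≡ proj₁ p′ → p ∙ l → p′ ∙ l → p ≡ p′
    unique-point refl refl refl = refl

    unique-line : ∀ {p l l′} → proj₁ l ≡ proj₁ l′ → p ∙ l → p ∙ l′ → l ≡ l′
    unique-line {x , _} {m , _} refl refl e = cong (m ,_) (+-cancelˡ (m ⊗ x) _ _ e)

    linear : ∀ {p p′ l l′} → p ≢ p′ → l ≢ l′ → p ∙ l → p′ ∙ l → p ∙ l′ → p′ ∙ l′ → ⊥
    linear {x , y} {x′ , y′} {m , b} {m′ , b′} p≢p′ l≢l′ pl p′l pl′ p′l′ =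
      Sum.[ (λ m≡m′ → l≢l′ (unique-line {x , y} m≡m′ pl pl′))
          , (λ x≡x′ → p≢p′ (unique-point {l = m , b} x≡x′ pl p′l))
          ] (two-points-one-line pr {m} {m′} {x} {x′} {b} {b′}
              (trans (sym pl) pl′) (trans (sym p′l) p′l′))

    _~_ : Rel (BVertex q) 0ℓ
    _~_ = Amalgamated _∙_ R₀ R₁

    sf : Squarefree _~_
    sf = amalgamated-squarefree proj₁ proj₁ proj₁ proj₁
      (λ {p} {p′} {l} → unique-point {p} {p′} {l}) (λ {p} {l} {l′} → unique-line {p} {l} {l′})
      (λ {p} {p′} {l} {l′} → linear {p} {p′} {l} {l′})
      R₀-squarefree R₁-squarefree (blockAdj-sym α S T 0 1 H₂ G₂ 1)
      (λ {p} {p′} {l} {l′} → R₀⊥R₁ {p} {p′} {l} {l′})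

    to : ∀ u v → Adj B* u v → value u ~ value v
    to (inj₁ _ , _) (inj₁ _ , _) (inj₂ e) = e
    to (inj₁ _ , _) (inj₂ _ , _) (inj₁ e) = e
    to (inj₂ _ , _) (inj₁ _ , _) (inj₁ e) = e
    to (inj₂ _ , _) (inj₂ _ , _) (inj₂ e) = e

  -- Degrees in the amalgam

  ≢⊕h : ∀ {y : Fin q} → y ≢ y ⊕ h
  ≢⊕h e = 0≢h (⊕-fixed⇒0 e)

  G₂-degree : ∀ b → ℕ
  G₂-degree b = length (filter (adj? G₂ b) (allFin q))

  G₂-degree-root : G₂-degree (ι 0) + 3 ≡ q
  G₂-degree-root = trans
    (length-complement (Fin-finite q) (adj? G₂ (ι 0)) {ι 0 ∷ h ∷ h′ ∷ []}
      ((0≢h ∷ 0≢h′ ∷ []) ∷ (h≢h′ ∷ []) ∷ [] ∷ []) es⊆ ⊆es)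
    (length-allFin q)
    where
    es⊆ : ∀ {z} → z List.∈ ι 0 ∷ h ∷ h′ ∷ [] → ¬ Adj G₂ (ι 0) z
    es⊆ (here refl)                 (0≢0 , _)                                 = 0≢0 refl
    es⊆ z∈                          (_ , inj₂ e)                              = root-is-sink e
    es⊆ (there (here refl))         (_ , inj₁ (inj₁ (_ , _ , h≢h , _)))       = h≢h refl
    es⊆ (there (there (here refl))) (_ , inj₁ (inj₁ (_ , _ , _ , h′≢h′)))     = h′≢h′ refl
    es⊆ (there _)                   (_ , inj₁ (inj₂ (inj₁ (0≡cₙ , _))))       = 0≢cₙ 0≡cₙ
    es⊆ (there _)                   (_ , inj₁ (inj₂ (inj₂ (0≡c , _))))        = 0≢c₃ₙ₊₁ 0≡c

    ⊆es : ∀ {z} → ¬ Adj G₂ (ι 0) z → z List.∈ ι 0 ∷ h ∷ h′ ∷ []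
    ⊆es {z} ¬e with z Fin.≟ ι 0 | z Fin.≟ h | z Fin.≟ h′
    ... | yes z≡0 | _       | _        = here z≡0
    ... | no _    | yes z≡h | _        = there (here z≡h)
    ... | no _    | no _    | yes z≡h′ = there (there (here z≡h′))
    ... | no z≢0  | no z≢h  | no z≢h′  = ⊥-elim (¬e (z≢0 ∘ sym , inj₁ (inj₁ (refl , z≢0 , z≢h , z≢h′))))

  G₂-degree-cₙ : G₂-degree cₙ ≡ 2
  G₂-degree-cₙ = count-is (adj? G₂ cₙ) (unique-pair 0≢h) to from
    where
    to : ∀ {z} → Adj G₂ cₙ z → z List.∈ ι 0 ∷ h ∷ []
    to (_ , inj₁ (inj₁ (e , _)))               = ⊥-elim (0≢cₙ (sym e))
    to (_ , inj₁ (inj₂ (inj₁ (_ , z≡h))))      = there (here z≡h)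
    to (_ , inj₁ (inj₂ (inj₂ (e , _))))        = ⊥-elim (cₙ≢c₃ₙ₊₁ e)
    to (_ , inj₂ (inj₁ (z≡0 , _)))             = here z≡0
    to (_ , inj₂ (inj₂ (inj₁ (_ , e))))        = ⊥-elim (cₙ≢h e)
    to (_ , inj₂ (inj₂ (inj₂ (_ , e))))        = ⊥-elim (cₙ≢h′ e)
    from : ∀ {z} → z List.∈ ι 0 ∷ h ∷ [] → Adj G₂ cₙ z
    from (here refl)         = 0≢cₙ ∘ sym , inj₂ (inj₁ (refl , 0≢cₙ ∘ sym , cₙ≢h , cₙ≢h′))
    from (there (here refl)) = cₙ≢h , inj₁ (inj₂ (inj₁ (refl , refl)))

  G₂-degree-c₃ₙ₊₁ : G₂-degree c₃ₙ₊₁ ≡ 2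
  G₂-degree-c₃ₙ₊₁ = count-is (adj? G₂ c₃ₙ₊₁) (unique-pair 0≢h′) to from
    where
    to : ∀ {z} → Adj G₂ c₃ₙ₊₁ z → z List.∈ ι 0 ∷ h′ ∷ []
    to (_ , inj₁ (inj₁ (e , _)))               = ⊥-elim (0≢c₃ₙ₊₁ (sym e))
    to (_ , inj₁ (inj₂ (inj₁ (e , _))))        = ⊥-elim (cₙ≢c₃ₙ₊₁ (sym e))
    to (_ , inj₁ (inj₂ (inj₂ (_ , z≡h′))))     = there (here z≡h′)
    to (_ , inj₂ (inj₁ (z≡0 , _)))             = here z≡0
    to (_ , inj₂ (inj₂ (inj₁ (_ , e))))        = ⊥-elim (h≢c₃ₙ₊₁ (sym e))
    to (_ , inj₂ (inj₂ (inj₂ (_ , e))))        = ⊥-elim (h′≢c₃ₙ₊₁ (sym e))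
    from : ∀ {z} → z List.∈ ι 0 ∷ h′ ∷ [] → Adj G₂ c₃ₙ₊₁ z
    from (here refl)         = 0≢c₃ₙ₊₁ ∘ sym ,
      inj₂ (inj₁ (refl , 0≢c₃ₙ₊₁ ∘ sym , h≢c₃ₙ₊₁ ∘ sym , h′≢c₃ₙ₊₁ ∘ sym))
    from (there (here refl)) = h′≢c₃ₙ₊₁ ∘ sym , inj₁ (inj₂ (inj₂ (refl , refl)))

  G₂-parent : ∀ b → b ≢ ι 0 → ∃[ p ] b ⇝₂ p
  G₂-parent b b≢0 with b Fin.≟ h | b Fin.≟ h′
  ... | yes b≡h | _        = cₙ , inj₂ (inj₁ (refl , b≡h))
  ... | no _    | yes b≡h′ = c₃ₙ₊₁ , inj₂ (inj₂ (refl , b≡h′))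
  ... | no b≢h  | no b≢h′  = ι 0 , inj₁ (refl , b≢0 , b≢h , b≢h′)

  G₂-degree-leaf : ∀ b → b ≢ ι 0 → b ≢ cₙ → b ≢ c₃ₙ₊₁ → G₂-degree b ≡ 1
  G₂-degree-leaf b b≢0 b≢cₙ b≢c₃ₙ₊₁ with p , b⇝p ← G₂-parent b b≢0 =
    count-is (adj? G₂ b) {p ∷ []} ([] ∷ []) to from
    where
    to : ∀ {z} → Adj G₂ b z → z List.∈ p ∷ []
    to (_ , inj₁ (inj₁ (e , _)))               = ⊥-elim (b≢0 e)
    to (_ , inj₁ (inj₂ (inj₁ (e , _))))        = ⊥-elim (b≢cₙ e)
    to (_ , inj₁ (inj₂ (inj₂ (e , _))))        = ⊥-elim (b≢c₃ₙ₊₁ e)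
    to (_ , inj₂ b⇝z)                          = here (⇝₂-functional b⇝z b⇝p)
    from : ∀ {z} → z List.∈ p ∷ [] → Adj G₂ b z
    -- A parent equal to b would be a loop, which could be followed three times.
    from (here refl) = (λ { refl → no-three-steps b⇝p b⇝p b⇝p }) , inj₂ b⇝p

  -- A line of intercept b contains the deleted point (0,b)₀ if b ∈ S, and no other deleted point.
  on-line? : ∀ b → Decidable (λ x → ¬ (x ≡ ι 0 × b ∈ S))
  on-line? b x = ¬? ((x Fin.≟ ι 0) ×-dec (b ∈ₛ? S))

  points-on-line : Fin q → List (Fin q)
  points-on-line b = filter (on-line? b) (allFin q)

  #points-∈S : ∀ {b} → b ∈ S → length (points-on-line b) + 1 ≡ q
  #points-∈S {b} b∈S = trans
    (length-complement (Fin-finite q) (on-line? b) {ι 0 ∷ []} ([] ∷ [])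
      (λ { (here refl) p → p (refl , b∈S) }) λ {x} → 0-off x)
    (length-allFin q)
    where
    0-off : ∀ x → ¬ ¬ (x ≡ ι 0 × b ∈ S) → x List.∈ ι 0 ∷ []
    0-off x ¬¬p with x Fin.≟ ι 0
    ... | yes x≡0 = here x≡0
    ... | no x≢0  = ⊥-elim (¬¬p (x≢0 ∘ proj₁))

  #points-∉S : ∀ {b} → b ∉ S → length (points-on-line b) ≡ q
  #points-∉S {b} b∉S = trans (sym (ℕ.+-identityʳ _)) (trans
    (length-complement (Fin-finite q) (on-line? b) {[]} [] (λ ()) (λ ¬¬p → ⊥-elim (¬¬p (b∉S ∘ proj₂))))
    (length-allFin q))

  line-degree : ∀ m b (k : Kept α S T 0 1 (inj₂ (m , b))) →
    degree B* (inj₂ (m , b) , [ k ]) ≡ length (points-on-line b) + G₂-degree b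
  line-degree m b k@(_ , m∉U) = trans
    (degree-refined B* (inj₂ (m , b) , [ k ]) unique-ns (λ {w} → to w) from)
    (trans (List.length-++ (map point (points-on-line b)))
      (cong₂ _+_ (List.length-map point (points-on-line b)) (List.length-map line lines)))
    where
    point line : Fin q → BVertex q
    point x = inj₁ (x , m ⊗ x ⊕ b)
    line b′ = inj₂ (m , b′)

    lines : List (Fin q)
    lines = filter (adj? G₂ b) (allFin q)

    ns : List (BVertex q)
    ns = map point (points-on-line b) ++ map line lines

    unique-ns : Unique ns
    unique-ns = Unique.++⁺
      (Unique.map⁺ (λ { refl → refl }) (Unique.filter⁺ (on-line? b) (Unique.allFin⁺ q)))
      (Unique.map⁺ (λ { refl → refl }) (Unique.filter⁺ (adj? G₂ b) (Unique.allFin⁺ q)))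
      disjoint
      where
      disjoint : ∀ {z} → ¬ (z List.∈ map point (points-on-line b) × z List.∈ map line lines)
      disjoint (z∈ , z∈′) with ∈-map⁻ point z∈ | ∈-map⁻ line z∈′
      ... | _ , _ , refl | _ , _ , ()

    at-0 : ∀ {x} → x ≡ ι 0 → m ⊗ x ⊕ b ≡ b
    at-0 refl = incident-at-0 {m}

    to : ∀ w → Adj B* (inj₂ (m , b) , [ k ]) w → value w List.∈ ns
    to (inj₁ (x , _) , [ k′ ]) (inj₁ refl) = ∈-++⁺ˡ (∈-map⁺ point (∈-filter⁺ (on-line? b) (∈-allFin x)
      (λ (x≡0 , b∈S) → proj₁ (recompute (kept? α S T 0 1 (point x)) k′)
        (x≡0 , subst (_∈ S) (sym (at-0 x≡0)) b∈S))))
    to (inj₂ (_ , b′) , _) (inj₂ e@(refl , _)) =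
      ∈-++⁺ʳ (map point (points-on-line b))
        (∈-map⁺ line (∈-filter⁺ (adj? G₂ b) (∈-allFin b′) (R₁⇒G₂ {m} e)))

    from : ∀ {v} → v List.∈ ns → ∃[ w ] value w ≡ v × Adj B* (inj₂ (m , b) , [ k ]) w
    from v∈ with ∈-++⁻ (map point (points-on-line b)) v∈
    ... | inj₁ v∈p with x , x∈ , refl ← ∈-map⁻ point v∈p =
      (point x , [ (λ (x≡0 , y∈S) → proj₂ (∈-filter⁻ (on-line? b) {xs = allFin q} x∈)
                     (x≡0 , subst (_∈ S) (at-0 x≡0) y∈S)) , ∉⊥ ]) , refl , inj₁ refl
    ... | inj₂ v∈l with b′ , b′∈ , refl ← ∈-map⁻ line v∈l =
      (line b′ , [ ∉⊥ ∘ proj₂ , m∉U ]) , refl ,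
      inj₂ (G₂⇒R₁ m∉U (proj₂ (∈-filter⁻ (adj? G₂ b) {xs = allFin q} b′∈)))

  block-of-point? : ∀ x y → Decidable (λ y′ → R₀ (x , y) (x , y′))
  block-of-point? x y y′ = blockAdj? α S T 0 1 H₁ G₁ 0 (x , y) (x , y′)

  block-degree : Fin q → Fin q → ℕ
  block-degree x y = length (filter (block-of-point? x y) (allFin q))

  slope? : Decidable (_≢ a)
  slope? m = ¬? (m Fin.≟ a)

  slopes : List (Fin q)
  slopes = filter slope? (allFin q)

  #slopes : length slopes + 1 ≡ q
  #slopes = trans
    (length-complement (Fin-finite q) slope? {a ∷ []} ([] ∷ [])
      (λ { (here refl) a≢a → a≢a refl }) (λ {m} → only-a m))
    (length-allFin q)
    where
    only-a : ∀ m → ¬ m ≢ a → m List.∈ a ∷ []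
    only-a m ¬m≢a with m Fin.≟ a
    ... | yes m≡a = here m≡a
    ... | no m≢a  = ⊥-elim (¬m≢a m≢a)

  intercept : ∀ {m x y b} → y ≡ m ⊗ x ⊕ b → b ≡ y ⊕ ⊝ (m ⊗ x)
  intercept {m} {x} {b = b} refl =
    sym (trans (cong (_⊕ ⊝ (m ⊗ x)) (+-comm (m ⊗ x) b)) (//-rightDividesʳ (m ⊗ x) b))

  on-intercept : ∀ m x y → y ≡ m ⊗ x ⊕ (y ⊕ ⊝ (m ⊗ x))
  on-intercept m x y = sym (trans (+-comm (m ⊗ x) _) (//-rightDividesˡ (m ⊗ x) y))

  -- Each remaining slope m contributes exactly one line through the point, that of intercept y - m
  -- x.
  point-degree : ∀ x y (k : Kept α S T 0 1 (inj₁ (x , y))) →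
    degree B* (inj₁ (x , y) , [ k ]) ≡ length slopes + block-degree x y
  point-degree x y k = trans
    (degree-refined B* (inj₁ (x , y) , [ k ]) unique-ns (λ {w} → to w) from)
    (trans (List.length-++ (map line slopes))
      (cong₂ _+_ (List.length-map line slopes) (List.length-map point points)))
    where
    point line : Fin q → BVertex q
    point y′ = inj₁ (x , y′)
    line m = inj₂ (m , y ⊕ ⊝ (m ⊗ x))

    points : List (Fin q)
    points = filter (block-of-point? x y) (allFin q)

    ns : List (BVertex q)
    ns = map line slopes ++ map point points

    unique-ns : Unique ns
    unique-ns = Unique.++⁺
      (Unique.map⁺ (λ { refl → refl }) (Unique.filter⁺ slope? (Unique.allFin⁺ q)))
      (Unique.map⁺ (λ { refl → refl }) (Unique.filter⁺ (block-of-point? x y) (Unique.allFin⁺ q)))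
      disjoint
      where
      disjoint : ∀ {z} → ¬ (z List.∈ map line slopes × z List.∈ map point points)
      disjoint (z∈ , z∈′) with ∈-map⁻ line z∈ | ∈-map⁻ point z∈′
      ... | _ , _ , refl | _ , _ , ()

    to : ∀ w → Adj B* (inj₁ (x , y) , [ k ]) w → value w List.∈ ns
    to (inj₂ (m , b) , [ k′ ]) (inj₁ e) with refl ← intercept {m} {x} {y} {b} e =
      ∈-++⁺ˡ (∈-map⁺ line (∈-filter⁺ slope? (∈-allFin m)
        (λ { refl → proj₂ (recompute (kept? α S T 0 1 (line m)) k′) a∈U₁ })))
    to (inj₁ (_ , y′) , _) (inj₂ e@(refl , _)) =
      ∈-++⁺ʳ (map line slopes) (∈-map⁺ point (∈-filter⁺ (block-of-point? x y) (∈-allFin y′) e))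

    kept-in-block : ∀ {y′} → R₀ (x , y) (x , y′) → Kept α S T 0 1 (point y′)
    kept-in-block {y′} (_ , inj₁ (_ , adj _ y′∉S _)) =
      recompute (¬? (y′ ∈ₛ? S)) y′∉S ∘ proj₂ , ∉⊥
    kept-in-block (_ , inj₂ ((x≢0 , _) , _)) = x≢0 ∘ proj₁ , ∉⊥

    from : ∀ {v} → v List.∈ ns → ∃[ w ] value w ≡ v × Adj B* (inj₁ (x , y) , [ k ]) w
    from v∈ with ∈-++⁻ (map line slopes) v∈
    ... | inj₁ v∈l with m , m∈ , refl ← ∈-map⁻ line v∈l =
      (line m , [ ∉⊥ ∘ proj₂ , ∉U₁ (proj₂ (∈-filter⁻ slope? {xs = allFin q} m∈)) ]) , refl ,
      inj₁ (on-intercept m x y)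
    ... | inj₂ v∈p with y′ , y′∈ , refl ← ∈-map⁻ point v∈p
      with e ← proj₂ (∈-filter⁻ (block-of-point? x y) {xs = allFin q} y′∈) =
      (point y′ , [ kept-in-block e ]) , refl , inj₂ e

  ⊕h≢⊕h′ : ∀ {y : Fin q} → y ⊕ h ≢ y ⊕ h′
  ⊕h≢⊕h′ e = h≢h′ (cancel-shift e)

  block-degree-off-0 : ∀ {x y} → x ≢ ι 0 → block-degree x y ≡ 2
  block-degree-off-0 {x} {y} x≢0 = count-is (block-of-point? x y) (unique-pair ⊕h≢⊕h′) to from
    where
    to : ∀ {z} → R₀ (x , y) (x , z) → z List.∈ y ⊕ h ∷ y ⊕ h′ ∷ []
    to e with R₀-off-0 x≢0 e
    ... | inj₁ y→z = here y→z
    ... | inj₂ z→y = there (here (shift-back z→y))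

    edge : ∀ {z} → y ⇝ z ⊎ z ⇝ y → R₀ (x , y) (x , z)
    edge e = refl , inj₂ ((x≢0 , ∉⊥) , (λ { refl → Sum.[ ≢⊕h , ≢⊕h ] e }) , e)

    from : ∀ {z} → z List.∈ y ⊕ h ∷ y ⊕ h′ ∷ [] → R₀ (x , y) (x , z)
    from (here e)         = edge (inj₁ e)
    from (there (here e)) = edge (inj₂ (shift-forth e))

  c₃ₙ∉S : c₃ₙ ∉ S
  c₃ₙ∉S = ∉S (cₙ≢c₃ₙ ∘ sym) c₃ₙ≢c₃ₙ₊₁

  cₙ₊₁∉S : cₙ₊₁ ∉ S
  cₙ₊₁∉S = ∉S (cₙ≢cₙ₊₁ ∘ sym) cₙ₊₁≢c₃ₙ₊₁

  ⊕h-injective : ∀ {y z : Fin q} → y ⊕ h ≡ z ⊕ h → y ≡ z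
  ⊕h-injective = +-cancelʳ h _ _

  -- The predecessors of the two elements of S are `c₃ₙ₊₁`, itself in S, and `cₙ₊₁`. Dually, for
  -- `predecessor∉S`, their successors are `cₙ`, itself in S, and `c₃ₙ`. So shifts enter or leave S
  -- only at the ends of the path.
  successor∉S : ∀ {y z} → y ∉ S → y ≢ cₙ₊₁ → y ⇝ z → z ∉ S
  successor∉S y∉S y≢ y→z z∈S with ∈S⁻ z∈S
  ... | inj₁ refl = y∉S (subst (_∈ S) (⊕h-injective (trans c₃ₙ₊₁⊕h≡cₙ y→z)) c₃ₙ₊₁∈S)
  ... | inj₂ refl = y≢ (⊕h-injective (trans (sym y→z) (sym cₙ₊₁⊕h≡c₃ₙ₊₁)))

  predecessor∉S : ∀ {y z} → y ∉ S → y ≢ c₃ₙ → z ⇝ y → z ∉ S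
  predecessor∉S y∉S y≢ z→y z∈S with ∈S⁻ z∈S
  ... | inj₁ refl = y≢ (trans z→y cₙ⊕h≡c₃ₙ)
  ... | inj₂ refl = y∉S (subst (_∈ S) (sym (trans z→y c₃ₙ₊₁⊕h≡cₙ)) cₙ∈S)

  predecessor≢cₙ₊₁ : ∀ {y z} → y ∉ S → z ⇝ y → z ≢ cₙ₊₁
  predecessor≢cₙ₊₁ y∉S z→y refl = y∉S (subst (_∈ S) (sym (trans z→y cₙ₊₁⊕h≡c₃ₙ₊₁)) c₃ₙ₊₁∈S)

  H₁-step : ∀ {y z} → y ∉ S → z ∉ S → y ≢ cₙ₊₁ → y ⇝ z → AdjIn H₁ y z
  H₁-step y∉S z∉S y≢ y→z = adj y∉S z∉S ((λ { refl → ≢⊕h y→z }) , inj₁ (inj₁ ((y∉S , y≢) , y→z)))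

  H₁-jump : AdjIn H₁ cₙ₊₁ c₃ₙ
  H₁-jump = adj cₙ₊₁∉S c₃ₙ∉S (cₙ₊₁≢c₃ₙ , inj₂ (inj₂ (refl , refl)))

  H₁-forth : ∀ {y z} → y ∉ S → y ≢ cₙ₊₁ → y ⇝ z → AdjIn H₁ y z
  H₁-forth y∉S y≢ y→z = H₁-step y∉S (successor∉S y∉S y≢ y→z) y≢ y→z

  H₁-back : ∀ {y z} → y ∉ S → y ≢ c₃ₙ → z ⇝ y → AdjIn H₁ y z
  H₁-back y∉S y≢ z→y = adjIn-sym H₁
    (H₁-step (predecessor∉S y∉S y≢ z→y) y∉S (predecessor≢cₙ₊₁ y∉S z→y) z→y)

  AdjIn-∉S : ∀ {y z} → AdjIn H₁ y z → z ∉ S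
  AdjIn-∉S {z = z} (adj _ z∉S _) = recompute (¬? (z ∈ₛ? S)) z∉S

  -- Inside the path the neighbours are the two shifts, as in G₁; at either end the shift that would
  -- fall into S is replaced by the other end.
  block-degree-at-0 : ∀ {x y} → x ≡ ι 0 → y ∉ S → block-degree x y ≡ 2
  block-degree-at-0 {x} {y} x≡0 y∉S with y Fin.≟ cₙ₊₁ | y Fin.≟ c₃ₙ
  ... | yes refl | _ = count-is (block-of-point? x y) (unique-pair distinct) to from
    where
    distinct : c₃ₙ ≢ y ⊕ h′
    distinct e = cₙ₊₁≢c₃ₙ⊕h (shift-forth e)

    to : ∀ {z} → R₀ (x , y) (x , z) → z List.∈ c₃ₙ ∷ y ⊕ h′ ∷ []
    to e with R₀-at-0 x≡0 e
    ... | inj₁ (inj₁ (c≢c , _))  = ⊥-elim (c≢c refl)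
    ... | inj₁ (inj₂ (_ , z≡))   = here z≡
    ... | inj₂ (inj₁ (_ , z→y))  = there (here (shift-back z→y))
    ... | inj₂ (inj₂ (_ , c≡c′)) = ⊥-elim (cₙ₊₁≢c₃ₙ c≡c′)

    from : ∀ {z} → z List.∈ c₃ₙ ∷ y ⊕ h′ ∷ [] → R₀ (x , y) (x , z)
    from (here refl)      = refl , inj₁ (x≡0 , H₁-jump)
    from (there (here e)) = refl , inj₁ (x≡0 , H₁-back y∉S cₙ₊₁≢c₃ₙ (shift-forth e))
  ... | no y≢ | yes refl = count-is (block-of-point? x y) (unique-pair cₙ₊₁≢c₃ₙ⊕h) to from
    where
    to : ∀ {z} → R₀ (x , y) (x , z) → z List.∈ cₙ₊₁ ∷ y ⊕ h ∷ []
    to e@(_ , e′) with R₀-at-0 x≡0 e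
    ... | inj₁ (inj₁ (_ , y→z))  = there (here y→z)
    ... | inj₁ (inj₂ (c≡c′ , _)) = ⊥-elim (y≢ c≡c′)
    ... | inj₂ (inj₂ (z≡ , _))   = here z≡
    -- The relation `_⇝ʰ_` still admits the step from the deleted ordinate `cₙ`; the adjacency proof
    -- itself has to be consulted to see that both ends lie outside S.
    ... | inj₂ (inj₁ (_ , z→y)) with refl ← ⊕h-injective (trans (sym z→y) (sym cₙ⊕h≡c₃ₙ)) | e′
    ...   | inj₁ (_ , e″)          = ⊥-elim (AdjIn-∉S e″ cₙ∈S)
    ...   | inj₂ ((x≢0 , _) , _)   = ⊥-elim (x≢0 x≡0)

    from : ∀ {z} → z List.∈ cₙ₊₁ ∷ y ⊕ h ∷ [] → R₀ (x , y) (x , z)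
    from (here refl)      = refl , inj₁ (x≡0 , adjIn-sym H₁ H₁-jump)
    from (there (here e)) = refl , inj₁ (x≡0 , H₁-forth y∉S y≢ e)
  ... | no y≢ | no y≢′ = count-is (block-of-point? x y) (unique-pair ⊕h≢⊕h′) to from
    where
    to : ∀ {z} → R₀ (x , y) (x , z) → z List.∈ y ⊕ h ∷ y ⊕ h′ ∷ []
    to e with R₀-at-0 x≡0 e
    ... | inj₁ (inj₁ (_ , y→z)) = here y→z
    ... | inj₁ (inj₂ (y≡ , _))  = ⊥-elim (y≢ y≡)
    ... | inj₂ (inj₁ (_ , z→y)) = there (here (shift-back z→y))
    ... | inj₂ (inj₂ (_ , y≡))  = ⊥-elim (y≢′ y≡)

    from : ∀ {z} → z List.∈ y ⊕ h ∷ y ⊕ h′ ∷ [] → R₀ (x , y) (x , z)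
    from (here e)         = refl , inj₁ (x≡0 , H₁-forth y∉S y≢ e)
    from (there (here e)) = refl , inj₁ (x≡0 , H₁-back y∉S y≢′ (shift-forth e))

  point-degree≡ : ∀ x y k → degree B* (inj₁ (x , y) , [ k ]) ≡ q + 1
  point-degree≡ x y k@(¬0S , _) = begin
    degree B* (inj₁ (x , y) , [ k ])    ≡⟨ point-degree x y k ⟩
    length slopes + block-degree x y    ≡⟨ cong (length slopes +_) (two (x Fin.≟ ι 0)) ⟩
    length slopes + (1 + 1)             ≡⟨ ℕ.+-assoc (length slopes) 1 1 ⟨
    length slopes + 1 + 1               ≡⟨ cong (_+ 1) #slopes ⟩
    q + 1                               ∎
    where
    open ≡-Reasoning
    two : Dec (x ≡ ι 0) → block-degree x y ≡ 2
    two (yes x≡0) = block-degree-at-0 x≡0 (λ y∈S → ¬0S (x≡0 , y∈S))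
    two (no x≢0)  = block-degree-off-0 x≢0

  0∉S : ι 0 ∉ S
  0∉S = ∉S 0≢cₙ 0≢c₃ₙ₊₁

  hub-degree : ∀ m k → degree B* (inj₂ (m , ι 0) , [ k ]) + 3 ≡ q + q
  hub-degree m k = begin
    degree B* (inj₂ (m , ι 0) , [ k ]) + 3                   ≡⟨ cong (_+ 3) (line-degree m (ι 0) k) ⟩
    length (points-on-line (ι 0)) + G₂-degree (ι 0) + 3      ≡⟨ ℕ.+-assoc (length (points-on-line (ι 0))) _ 3 ⟩
    length (points-on-line (ι 0)) + (G₂-degree (ι 0) + 3)    ≡⟨ cong₂ _+_ (#points-∉S 0∉S) G₂-degree-root ⟩
    q + q                                                    ∎
    where open ≡-Reasoning

  line-degree≡ : ∀ m b k → b ≢ ι 0 → degree B* (inj₂ (m , b) , [ k ]) ≡ q + 1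
  line-degree≡ m b k b≢0 = trans (line-degree m b k) (count (b Fin.≟ cₙ) (b Fin.≟ c₃ₙ₊₁))
    where
    at-S : b ∈ S → G₂-degree b ≡ 2 → length (points-on-line b) + G₂-degree b ≡ q + 1
    at-S b∈S two = trans (cong (length (points-on-line b) +_) two)
      (trans (sym (ℕ.+-assoc _ 1 1)) (cong (_+ 1) (#points-∈S b∈S)))

    count : Dec (b ≡ cₙ) → Dec (b ≡ c₃ₙ₊₁) → length (points-on-line b) + G₂-degree b ≡ q + 1
    count (yes refl) _          = at-S cₙ∈S G₂-degree-cₙ
    count (no _)     (yes refl) = at-S c₃ₙ₊₁∈S G₂-degree-c₃ₙ₊₁
    count (no b≢cₙ)  (no b≢c)   = cong₂ _+_ (#points-∉S (∉S b≢cₙ b≢c)) (G₂-degree-leaf b b≢0 b≢cₙ b≢c)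

  origin-kept : Kept α S T 0 1 (inj₁ (ι 0 , ι 0))
  origin-kept = 0∉S ∘ proj₂ , ∉⊥

  hub-kept : ∀ {m} → m ≢ a → Kept α S T 0 1 (inj₂ (m , ι 0))
  hub-kept m≢a = ∉⊥ ∘ proj₂ , ∉U₁ m≢a

  origin : [ v ∈ BVertex q ∣ Kept α S T 0 1 v ]
  origin = inj₁ (ι 0 , ι 0) , [ origin-kept ]

  hub : ∀ {m} → m ≢ a → [ v ∈ BVertex q ∣ Kept α S T 0 1 v ]
  hub {m} m≢a = inj₂ (m , ι 0) , [ hub-kept m≢a ]

  degree-cases : ∀ v → degree B* v ≡ q + 1 ⊎ degree B* v + 3 ≡ q + q
  degree-cases (inj₁ (x , y) , [ k ]) =
    inj₁ (point-degree≡ x y (recompute (kept? α S T 0 1 (inj₁ (x , y))) k))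
  degree-cases (inj₂ (m , b) , [ k ]) =
    on-line b (b Fin.≟ ι 0) (recompute (kept? α S T 0 1 (inj₂ (m , b))) k)
    where
    on-line : ∀ b → Dec (b ≡ ι 0) → (k : Kept α S T 0 1 (inj₂ (m , b))) →
              degree B* (inj₂ (m , b) , [ k ]) ≡ q + 1 ⊎ degree B* (inj₂ (m , b) , [ k ]) + 3 ≡ q + q
    on-line .(ι 0) (yes refl) k = inj₂ (hub-degree m k)
    on-line b      (no b≢0)   k = inj₁ (line-degree≡ m b k b≢0)

  -- The order of the amalgam

  order≡ : order B* + (2 + q) ≡ q * q + q * q
  order≡ = begin
    order B* + (2 + q)
      ≡⟨ cong₂ _+_ (card-refinement kept (finite B)) (sym length-deleted) ⟩
    length (filter kept (elements (finite B))) + length deleted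
      ≡⟨ length-complement (finite B) kept unique-deleted deleted⁻ (λ {v} → deleted⁺ v) ⟩
    card (finite B)
      ≡⟨ List.length-++ (map inj₁ pairs) ⟩
    length (map inj₁ pairs) + length (map inj₂ pairs)
      ≡⟨ cong₂ _+_ (#pairs inj₁) (#pairs inj₂) ⟩
    q * q + q * q ∎
    where
    open ≡-Reasoning
    kept : Decidable (Kept α S T 0 1)
    kept = kept? α S T 0 1

    pairs : List (Fin q × Fin q)
    pairs = cartesianProduct (allFin q) (allFin q)

    #pairs : (f : Fin q × Fin q → BVertex q) → length (map f pairs) ≡ q * q
    #pairs f = trans (List.length-map f pairs)
      (trans (length-cartesianProduct (allFin q) (allFin q)) (cong₂ _*_ (length-allFin q) (length-allFin q)))

    deleted-block deleted : List (BVertex q)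
    deleted-block = map (λ b → inj₂ (a , b)) (allFin q)
    deleted = inj₁ (ι 0 , cₙ) ∷ inj₁ (ι 0 , c₃ₙ₊₁) ∷ deleted-block

    length-deleted : length deleted ≡ 2 + q
    length-deleted = cong (2 +_) (trans (List.length-map _ (allFin q)) (length-allFin q))

    ≢block : ∀ {p} → All (inj₁ p ≢_) deleted-block
    ≢block = All.tabulate λ v∈ e → absurd (∈-map⁻ _ v∈) e
      where
      absurd : ∀ {p v} → ∃[ b ] b List.∈ allFin q × v ≡ inj₂ (a , b) → inj₁ p ≢ v
      absurd (_ , _ , refl) ()

    unique-deleted : Unique deleted
    unique-deleted = ((λ e → cₙ≢c₃ₙ₊₁ (cong proj₂ (inj₁-injective e))) ∷ ≢block) ∷ ≢block
      ∷ Unique.map⁺ (λ { refl → refl }) (Unique.allFin⁺ q)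

    deleted⁻ : ∀ {v} → v List.∈ deleted → ¬ Kept α S T 0 1 v
    deleted⁻ (here refl)         (¬0S , _) = ¬0S (refl , cₙ∈S)
    deleted⁻ (there (here refl)) (¬0S , _) = ¬0S (refl , c₃ₙ₊₁∈S)
    deleted⁻ (there (there v∈)) k with _ , _ , refl ← ∈-map⁻ _ v∈ = proj₂ k a∈U₁

    deleted⁺ : ∀ v → ¬ Kept α S T 0 1 v → v List.∈ deleted
    deleted⁺ (inj₁ (x , y)) ¬k with x Fin.≟ ι 0 | y Fin.≟ cₙ | y Fin.≟ c₃ₙ₊₁
    ... | yes refl | yes refl | _        = here refl
    ... | yes refl | no _     | yes refl = there (here refl)
    ... | yes refl | no y≢    | no y≢′   = ⊥-elim (¬k (∉S y≢ y≢′ ∘ proj₂ , ∉⊥))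
    ... | no x≢0   | _        | _        = ⊥-elim (¬k (x≢0 ∘ proj₁ , ∉⊥))
    deleted⁺ (inj₂ (m , b)) ¬k with m Fin.≟ a
    ... | yes refl = there (there (∈-map⁺ _ (∈-allFin b)))
    ... | no m≢a   = ⊥-elim (¬k (∉⊥ ∘ proj₂ , ∉U₁ m≢a))

  -- A cycle of length five

  unit-point : Fin q → [ v ∈ BVertex q ∣ Kept α S T 0 1 v ]
  unit-point y = inj₁ (ι 1 , y) , [ 0≢1 ∘ sym ∘ proj₁ , ∉⊥ ]

  -- The corners are (1,0)₀, (1,s)₀, (s,0)₁, (0,0)₀, (0,0)₁: the lines of slopes s and 0 through the
  -- origin meet the class P_1 in two points joined by an edge of G₁ when s = ±h. Since ±h are
  -- distinct, one of them differs from the deleted slope.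
  pentagon : ∀ {s} → s ≢ a → ι 0 ≢ s → (ι 0 ⇝ s ⊎ s ⇝ ι 0) →
             ∃[ v ] ∃[ vs ] IsCycle B* v vs × length (v ∷ vs) ≡ 5
  pentagon {s} s≢a 0≢s e =
    unit-point (ι 0) , unit-point s ∷ hub s≢a ∷ origin ∷ hub (a≢0 ∘ sym) ∷ [] , record
      { long     = s≤s (s≤s (s≤s z≤n))
      ; distinct =
          ((λ eq → 0≢s (cong proj₂ (inj₁-injective (cong value eq)))) ∷ (λ ()) ∷ 1≢0-point ∷ (λ ()) ∷ [])
          ∷ ((λ ()) ∷ 1≢0-point ∷ (λ ()) ∷ [])
          ∷ ((λ ()) ∷ (λ eq → 0≢s (sym (cong proj₁ (inj₂-injective (cong value eq))))) ∷ [])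
          ∷ ((λ ()) ∷ [])
          ∷ [] ∷ []
      ; closed   = inj₂ (refl , inj₂ ((0≢1 ∘ sym , ∉⊥) , 0≢s , e))
          ∷ inj₁ (sym (trans (+-identityʳ _) (*-identityʳ s)))
          ∷ inj₁ (sym (incident-at-0 {s}))
          ∷ inj₁ (sym (incident-at-0 {ι 0}))
          ∷ inj₁ (sym (trans (+-identityʳ _) (zeroˡ (ι 1))))
          ∷ [-]
      } , refl
    where
    1≢0-point : ∀ {y} → unit-point y ≢ origin
    1≢0-point eq = 0≢1 (sym (cong proj₁ (inj₁-injective (cong value eq))))

  B*-girth : HasGirth B* 5
  B*-girth = record
    { attained = attained (h Fin.≟ a)
    ; shortest = squarefree⇒cycle≥5 B* B*-squarefree
    }
    where
    attained : Dec (h ≡ a) → ∃[ v ] ∃[ vs ] IsCycle B* v vs × length (v ∷ vs) ≡ 5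
    attained (no h≢a)  = pentagon h≢a 0≢h (inj₁ (sym (+-identityˡ h)))
    attained (yes h≡a) = pentagon (λ h′≡a → h≢h′ (trans h≡a (sym h′≡a))) 0≢h′
      (inj₂ (sym (trans (+-comm h′ h) h⊕h′≡0)))

  -- The degree set and minimality

  module _ (r : ℕ) (r≡ : r ≡ q + 1) where

    private
      t : ℕ
      t = 4 * j + 10

      q≡t+3 : q ≡ t + 3
      q≡t+3 = trans q≡ (sym (ℕ.+-assoc (4 * j) 10 3))

    m≡ : 2 * r ∸ 5 ≡ q + t
    m≡ = trans (cong (λ r → 2 * r ∸ 5) r≡) (large-degree q≡t+3)

    hub-degree⇒m : ∀ {d} → d + 3 ≡ q + q → d ≡ 2 * r ∸ 5
    hub-degree⇒m {d} e = trans (ℕ.+-cancelʳ-≡ 3 d (q + t) (trans e q+q≡)) (sym m≡)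
      where
      q+q≡ : q + q ≡ q + t + 3
      q+q≡ = trans (cong (q +_) q≡t+3) (sym (ℕ.+-assoc q t 3))

    isGraph : Is[ r , 2 * r ∸ 5 ⨾ 5 ]-graph B*
    isGraph = record
      { girth   = B*-girth
      ; degrees = λ d → mk⇔
          (λ (v , e) → subst (λ d → d ≡ r ⊎ d ≡ 2 * r ∸ 5) e
            (Sum.map (λ e → trans e (sym r≡)) hub-degree⇒m (degree-cases v)))
          Sum.[ (λ { refl → origin , trans (point-degree≡ (ι 0) (ι 0) origin-kept) (sym r≡) })
              , (λ { refl → hub (a≢0 ∘ sym) , hub-degree⇒m (hub-degree (ι 0) (hub-kept (a≢0 ∘ sym))) }) ]
      }

    order-formula : order B* ≡ r * (2 * r ∸ 5) + 1
    order-formula = ℕ.+-cancelʳ-≡ (2 + q) _ _ (trans order≡ (trans (moore-number q≡t+3)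
      (cong (λ k → k + 1 + (2 + q)) (sym (cong₂ _*_ r≡ m≡)))))

    -- The degree set of the competitor supplies both inputs of the bound: a vertex of degree 2r - 5
    -- to serve as centre, and r as a lower bound for every degree.
    minimal : ∀ {W : Set} (G′ : Graph W) → Is[ r , 2 * r ∸ 5 ⨾ 5 ]-graph G′ → order B* ≤ order G′
    minimal G′ isG′ = bound (Equivalence.from (degrees (2 * r ∸ 5)) (inj₂ refl))
      where
      open Is[_,_⨾_]-graph isG′

      min-degree : ∀ w → suc q ≤ degree G′ w
      min-degree w with Equivalence.to (degrees (degree G′ w)) (w , refl)
      ... | inj₁ e = ℕ.≤-reflexive (trans (ℕ.+-comm 1 q) (sym (trans e r≡)))
      ... | inj₂ e = subst (suc q ≤_) (sym (trans e m≡))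
        (subst (_≤ q + t) (ℕ.+-comm q 1) (ℕ.+-monoʳ-≤ q (ℕ.≤-trans (s≤s z≤n) (ℕ.m≤n+m 10 (4 * j)))))

      bound : ∃[ v ] degree G′ v ≡ 2 * r ∸ 5 → order B* ≤ order G′
      bound (v , deg-v) = begin
        order B*                  ≡⟨ order-formula ⟩
        r * (2 * r ∸ 5) + 1       ≡⟨ cong (_+ 1) (ℕ.*-comm r _) ⟩
        (2 * r ∸ 5) * r + 1       ≡⟨ cong (_+ 1) (cong₂ _*_ (sym deg-v) (trans r≡ (ℕ.+-comm q 1))) ⟩
        degree G′ v * suc q + 1   ≤⟨ moore-bound G′ (girth5⇒squarefree G′ girth) v min-degree ⟩
        order G′                  ∎
        where open ℕ.≤-Reasoning

theorem5p2 : ∀ (n q r : ℕ) .{{_ : NonZero q}} →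
    q ≡ 4 * n + 1 → Prime q → 3 ≤ n → r ≡ q + 1 →
    ∀ (α : Fin q) → IsGenerator α →
    let B* = amalgam α S T 0 1 H₁ H₂ G₁ G₂ in
    Is[ r , 2 * r ∸ 5 ⨾ 5 ]-cage B* × Graph.order B* ≡ r * (2 * r ∸ 5) + 1
theorem5p2 n q r q≡ pr 3≤n r≡ α (α≢0 , _) with j , refl ← ℕ.m≤n⇒∃[o]m+o≡n 3≤n =
  record { isGraph = isGraph r r≡ ; minimal = minimal r r≡ } , order-formula r r≡
  where
  shift : ∀ j → 4 * (3 + j) + 1 ≡ 4 * j + 13
  shift = solve-∀
  open AmalgamGraph q j (trans q≡ (shift j)) pr α α≢0
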